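{- Up to projective equivalence, there are exactly two $3$-dimensional pseudo-ovals in ${\rm PG}(8,2)$, and each of them is elementary: one arises from a conic and the other from a pointed conic of ${\rm PG}(2,8)$.
   Context: An $n$-dimensional pseudo-oval in ${\rm PG}(3n-1,q)$ is a set of $q^n+1$ subspaces of projective dimension $n-1$ such that any three span the whole space; projective equivalence is under ${\rm P\Gamma L}(3n,q)$. It is elementary if obtained from an oval (set of $q^n+1$ points, no three collinear) of ${\rm PG}(2,q^n)$ by identifying ${\rm GF}(q)^{3n}$ with ${\rm GF}(q^n)^3$, so that points of ${\rm PG}(2,q^n)$ become $(n-1)$-dimensional subspaces of ${\rm PG}(3n-1,q)$. For $q$ even, a pointed conic of ${\rm PG}(2,q)$ is the oval $\{(1,t,t^2):t\in{\rm GF}(q)\}\cup\{(0,1,0)\}$ (a conic with one point replaced by the conic's nucleus). -}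

module Defs where

open import Data.Bool using (Bool; true; false; _xor_; _∧_)
open import Data.Nat using (ℕ)
open import Data.Fin using (Fin; zero; suc)
open import Data.Vec using (Vec; []; _∷_; map; zipWith; replicate; _++_; foldr)
open import Data.Product using (Σ; ∃; ∃-syntax; _×_; _,_)
open import Relation.Binary.PropositionalEquality using (_≡_; _≢_)

-- GF(2) = Bool (xor = +, ∧ = ·);  vectors of GF(2)^n as Vec Bool n

V : ℕ → Set
V n = Vec Bool n

_⊕_ : ∀ {n} → V n → V n → V n
_⊕_ = zipWith _xor_

scale : ∀ {n} → Bool → V n → V n
scale b = map (b ∧_)

V9 : Set
V9 = V 9

-- (n-1)-dimensional projective subspaces with n = 3: a subspace of
-- GF(2)^9 given as the GF(2)-span of three generating vectors.
-- (The pseudo-oval condition forces the generators to be independent.)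

Subspace : Set
Subspace = Fin 3 → V9

_∈S_ : V9 → Subspace → Set
v ∈S S = Σ (Fin 3 → Bool) (λ c → v ≡ (scale (c zero) (S zero) ⊕ (scale (c (suc zero)) (S (suc zero))
                       ⊕ scale (c (suc (suc zero))) (S (suc (suc zero))))))

_≈S_ : Subspace → Subspace → Set
S ≈S T = ∀ (v : V9) → ((v ∈S S → v ∈S T) × (v ∈S T → v ∈S S))

-- n-dimensional pseudo-ovals (n = 3, q = 2): q^n + 1 = 9 subspaces,
-- indexed by Fin 9, any three (distinct) of which span GF(2)^9.

Family : Set
Family = Fin 9 → Subspace

IsPseudoOval : Family → Set
IsPseudoOval O =
  ∀ (i j k : Fin 9) → i ≢ j → j ≢ k → i ≢ k →
  ∀ (v : V9) → ∃[ x ] ∃[ y ] ∃[ z ]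
     (x ∈S O i × y ∈S O j × z ∈S O k × v ≡ (x ⊕ (y ⊕ z)))

-- Linear maps GF(2)^9 → GF(2)^9 as 9×9 matrices; PΓL(9,2) = GL(9,2)
-- (GF(2) has trivial automorphism group and trivial scalars).

Matrix : Set
Matrix = Vec (Vec Bool 9) 9

dot : ∀ {n} → V n → V n → Bool
dot u v = foldr (λ _ → Bool) _xor_ false (zipWith _∧_ u v)

apply : Matrix → V9 → V9
apply M v = map (λ row → dot row v) M

Invertible : Matrix → Set
Invertible M = ∃[ N ] ((∀ (v : V9) → apply N (apply M v) ≡ v) × (∀ (v : V9) → apply M (apply N v) ≡ v))

image : Matrix → Subspace → Subspace
image M S i = apply M (S i)

Equivalent : Family → Family → Set
Equivalent O O' = ∃[ M ] (Invertible M × (∀ (i : Fin 9) → ∃[ j ] (image M (O i) ≈S O' j)))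

-- GF(8) = GF(2)[x]/(x^3 + x + 1), elements a0 + a1 x + a2 x^2 as Vec Bool 3

GF8 : Set
GF8 = Vec Bool 3

zero8 one8 x8 x²8 : GF8
zero8 = false ∷ false ∷ false ∷ []
one8  = true ∷ false ∷ false ∷ []
x8    = false ∷ true ∷ false ∷ []
x²8   = false ∷ false ∷ true ∷ []

mulX : GF8 → GF8
mulX (a0 ∷ a1 ∷ a2 ∷ []) = a2 ∷ (a0 xor a2) ∷ a1 ∷ []

_*8_ : GF8 → GF8 → GF8
(a0 ∷ a1 ∷ a2 ∷ []) *8 b = scale a0 b ⊕ (scale a1 (mulX b) ⊕ scale a2 (mulX (mulX b)))

-- points of PG(2,8) given by homogeneous coordinates in GF(8)^3
Point28 : Set
Point28 = GF8 × GF8 × GF8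

toV9 : Point28 → V9
toV9 (a , b , c) = a ++ (b ++ c)

scaleP : GF8 → Point28 → Point28
scaleP λ' (a , b , c) = (λ' *8 a , λ' *8 b , λ' *8 c)

-- the point P of PG(2,8) as a subspace of PG(8,2): {λP : λ ∈ GF(8)},
-- spanned over GF(2) by P, xP, x^2 P
pointSubspace : Point28 → Subspace
pointSubspace P zero = toV9 (scaleP one8 P)
pointSubspace P (suc zero) = toV9 (scaleP x8 P)
pointSubspace P (suc (suc zero)) = toV9 (scaleP x²8 P)

elementary : (Fin 9 → Point28) → Family
elementary pts i = pointSubspace (pts i)

elem8 : Fin 8 → GF8
elem8 zero = false ∷ false ∷ false ∷ []
elem8 (suc zero) = true ∷ false ∷ false ∷ []
elem8 (suc (suc zero)) = false ∷ true ∷ false ∷ []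
elem8 (suc (suc (suc zero))) = true ∷ true ∷ false ∷ []
elem8 (suc (suc (suc (suc zero)))) = false ∷ false ∷ true ∷ []
elem8 (suc (suc (suc (suc (suc zero))))) = true ∷ false ∷ true ∷ []
elem8 (suc (suc (suc (suc (suc (suc zero)))))) = false ∷ true ∷ true ∷ []
elem8 (suc (suc (suc (suc (suc (suc (suc zero))))))) = true ∷ true ∷ true ∷ []

affineConicPt : Fin 8 → Point28
affineConicPt i = (one8 , elem8 i , elem8 i *8 elem8 i)

conic : Fin 9 → Point28
conic (suc i) = affineConicPt i
conic zero = (zero8 , zero8 , one8)

-- pointed conic {(1,t,t^2)} ∪ {(0,1,0)}  (the nucleus replaces (0,0,1))
pointedConic : Fin 9 → Point28
pointedConic (suc i) = affineConicPt i
pointedConic zero = (zero8 , one8 , zero8)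

{-# OPTIONS --safe #-}

-- Four planes of a pseudo-oval can be moved to (x,0,0), (0,x,0), (0,0,x) and (x,x,x); the other
-- five are then graphs (x, Px, Qx), and P, Q and QP⁻¹ run through sets of 3 × 3 matrices over
-- GF(2) whose differences, also with 0 and 1, are invertible.  There are 48 candidates for such
-- a matrix, and three of them with invertible differences always commute; hence the P's, the
-- Q's and the QP⁻¹'s each lie in a field of order 8, and a check on pairs shows that these
-- fields coincide.  So the pseudo-oval is an oval of PG(2,8) containing the standard frame.
-- Every 7-arc containing the frame lies on one of ten hyperovals, each projectively a conic with
-- its nucleus; the tenth point, missing from the oval, is either the nucleus or can be moved
-- to (0,0,1) by the group of the conic.
--
-- The two families are inequivalent because the quadratic map y² + xz vanishes exactly on the
-- conic, whereas every quadratic map over GF(2) vanishing on the pointed conic also vanishes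
-- at its nucleus (0,0,1).
module Submission where

open import Defs
open import Algebra.Bundles using (CommutativeSemiring)
open import Algebra.Solver.Ring.AlmostCommutativeRing using (fromCommutativeSemiring)
import Algebra.Solver.Ring.Simple as RingSolver
open import Algebra.Structures.Biased using (isCommutativeSemiringˡ)
open import Data.Bool as Bool using (Bool; true; false; _xor_; _∧_; _∨_; not; T)
open import Data.Bool.ListAction using (all; any)
open import Data.Bool.Properties
  using (T?; xor-assoc; xor-comm; xor-identityʳ; xor-same; ∧-identityʳ; ∧-zeroʳ; ∧-distribˡ-xor)
open import Data.Empty using (⊥-elim)
open import Data.Fin using (Fin; zero; suc; combine; remQuot; _≟_)
open import Data.Fin.Properties
  using (all?; any?; injective⇒≤; combine-remQuot; remQuot-combine; suc-injective; 2↔Bool)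
open import Data.List as List using (List; []; _∷_; filterᵇ; foldr; null; cartesianProduct; allFin)
open import Data.List.Membership.Propositional using (_∈_)
open import Data.List.Membership.Propositional.Properties
  using (∈-filter⁺; ∈-filter⁻; ∈-++⁺ˡ; ∈-++⁺ʳ; ∈-map⁺; ∈-map⁻; ∈-allFin;
         ∈-cartesianProduct⁺; ∈-cartesianProduct⁻)
open import Data.List.Relation.Unary.Any using (here; there)
open import Data.Nat using (ℕ; zero; suc; _^_)
import Data.Nat.Properties as ℕ
open import Data.Product using (Σ; ∃-syntax; _×_; _,_; proj₁; proj₂)
open import Data.Sum as Sum using (_⊎_; inj₁; inj₂; [_,_]′)
open import Data.Unit using (tt)
open import Data.Vec using (Vec; []; _∷_; map; zipWith; replicate; lookup; tabulate)
open import Data.Vec.Properties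
  using (≡-dec; zipWith-assoc; zipWith-comm; tabulate∘lookup; lookup-zipWith; tabulate-cong; tabulate-∘)
open import Function using (_∘_; Injective; Inverse)
open import Level using (0ℓ)
open import Relation.Binary.PropositionalEquality
open import Relation.Nullary using (¬_; yes; no)
open import Relation.Nullary.Decidable using (⌊_⌋; toWitness; ¬?)

-- Vector spaces over GF(2)

-- Projecting the pseudo-oval from one of its planes gives eight planes of a 6-dimensional vector
-- space that pairwise meet in 0: a spread lacking one member. The projections from the three
-- coordinate planes are described by `P`, `Q` and `QP⁻¹`, whence three families of matrices. A
-- candidate has neither 0 nor 1 as an eigenvalue, and a cubic over GF(2) without roots is
-- irreducible; so the candidates are the 48 elements of order 7 of GL(3,2), and each generates a
-- field of order 8 that is also its centralizer. The difficulty is that the three families could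
-- live in different fields: there are non-commuting candidates `P` and `R` whose product `RP` is
-- again a candidate. A single graph thus does not decide how the fields lie, and the check on pairs
-- has to look at two graphs at once. As soon as one `P` commutes with all the other matrices, they
-- all lie in its centralizer, and the planes are points over that field.

0V : ∀ {n} → V n
0V {n} = replicate n false

⊕-assoc : ∀ {n} (x y z : V n) → (x ⊕ y) ⊕ z ≡ x ⊕ (y ⊕ z)
⊕-assoc = zipWith-assoc xor-assoc

⊕-comm : ∀ {n} (x y : V n) → x ⊕ y ≡ y ⊕ x
⊕-comm = zipWith-comm xor-comm

⊕-identityˡ : ∀ {n} (x : V n) → 0V ⊕ x ≡ x
⊕-identityˡ []      = refl
⊕-identityˡ (b ∷ x) = cong (b ∷_) (⊕-identityˡ x)

⊕-identityʳ : ∀ {n} (x : V n) → x ⊕ 0V ≡ x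
⊕-identityʳ x = trans (⊕-comm x 0V) (⊕-identityˡ x)

⊕-self : ∀ {n} (x : V n) → x ⊕ x ≡ 0V
⊕-self []      = refl
⊕-self (b ∷ x) = cong₂ _∷_ (xor-same b) (⊕-self x)

⊕-interchange : ∀ {n} (x y z w : V n) → (x ⊕ y) ⊕ (z ⊕ w) ≡ (x ⊕ z) ⊕ (y ⊕ w)
⊕-interchange x y z w = begin
  (x ⊕ y) ⊕ (z ⊕ w)  ≡⟨ ⊕-assoc x y (z ⊕ w) ⟩
  x ⊕ (y ⊕ (z ⊕ w))  ≡⟨ cong (x ⊕_) (sym (⊕-assoc y z w)) ⟩
  x ⊕ ((y ⊕ z) ⊕ w)  ≡⟨ cong (λ u → x ⊕ (u ⊕ w)) (⊕-comm y z) ⟩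
  x ⊕ ((z ⊕ y) ⊕ w)  ≡⟨ cong (x ⊕_) (⊕-assoc z y w) ⟩
  x ⊕ (z ⊕ (y ⊕ w))  ≡⟨ sym (⊕-assoc x z (y ⊕ w)) ⟩
  (x ⊕ z) ⊕ (y ⊕ w)  ∎
  where open ≡-Reasoning

⊕-zero⇒≡ : ∀ {n} {x y : V n} → x ⊕ y ≡ 0V → x ≡ y
⊕-zero⇒≡ {x = x} {y} x⊕y≡0 = begin
  x            ≡⟨ sym (⊕-identityʳ x) ⟩
  x ⊕ 0V       ≡⟨ cong (x ⊕_) (sym (⊕-self y)) ⟩
  x ⊕ (y ⊕ y)  ≡⟨ sym (⊕-assoc x y y) ⟩
  (x ⊕ y) ⊕ y  ≡⟨ cong (_⊕ y) x⊕y≡0 ⟩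
  0V ⊕ y       ≡⟨ ⊕-identityˡ y ⟩
  y            ∎
  where open ≡-Reasoning

≡⇒⊕-zero : ∀ {n} {x y : V n} → x ≡ y → x ⊕ y ≡ 0V
≡⇒⊕-zero {y = y} refl = ⊕-self y

scale-xor : ∀ {n} a b (x : V n) → scale (a xor b) x ≡ scale a x ⊕ scale b x
scale-xor a     b     []      = refl
scale-xor false false (y ∷ x) = cong (false ∷_) (scale-xor false false x)
scale-xor false true  (y ∷ x) = cong (y ∷_) (scale-xor false true x)
scale-xor true  false (y ∷ x) = cong₂ _∷_ (sym (xor-identityʳ y)) (scale-xor true false x)
scale-xor true  true  (y ∷ x) = cong₂ _∷_ (sym (xor-same y)) (scale-xor true true x)

scale-true : ∀ {n} (x : V n) → scale true x ≡ x
scale-true []      = refl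
scale-true (b ∷ x) = cong (b ∷_) (scale-true x)

scale-false : ∀ {n} (x : V n) → scale false x ≡ 0V
scale-false []      = refl
scale-false (b ∷ x) = cong (false ∷_) (scale-false x)

Additive : ∀ {m n} → (V m → V n) → Set
Additive f = ∀ x y → f (x ⊕ y) ≡ f x ⊕ f y

module _ {m n} {f : V m → V n} (f-add : Additive f) where

  additive-zero : f 0V ≡ 0V
  additive-zero = begin
    f 0V            ≡⟨ cong f (sym (⊕-self 0V)) ⟩
    f (0V ⊕ 0V)     ≡⟨ f-add 0V 0V ⟩
    f 0V ⊕ f 0V     ≡⟨ ⊕-self (f 0V) ⟩
    0V              ∎
    where open ≡-Reasoning

  additive-scale : ∀ b x → f (scale b x) ≡ scale b (f x)
  additive-scale true  x = trans (cong f (scale-true x)) (sym (scale-true (f x)))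
  additive-scale false x =
    trans (cong f (scale-false x)) (trans additive-zero (sym (scale-false (f x))))

  kernel-zero⇒injective : (∀ x → f x ≡ 0V → x ≡ 0V) → ∀ {x y} → f x ≡ f y → x ≡ y
  kernel-zero⇒injective ker {x} {y} fx≡fy =
    ⊕-zero⇒≡ (ker (x ⊕ y) (trans (f-add x y) (≡⇒⊕-zero fx≡fy)))

∘-additive : ∀ {l m n} {g : V m → V n} {f : V l → V m} →
             Additive g → Additive f → Additive (g ∘ f)
∘-additive {g = g} g-add f-add x y = trans (cong g (f-add x y)) (g-add _ _)

⊕-additive : ∀ {m n} {f g : V m → V n} →
             Additive f → Additive g → Additive (λ x → f x ⊕ g x)
⊕-additive {f = f} {g} f-add g-add x y =
  trans (cong₂ _⊕_ (f-add x y) (g-add x y)) (⊕-interchange (f x) (f y) (g x) (g y))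

-- Finiteness

-- A missed value could serve as the image of one more element, which would inject n + 1 elements
-- into n.
injective⇒surjective : ∀ {n} {f : Fin n → Fin n} → Injective _≡_ _≡_ f → ∀ y → ∃[ x ] f x ≡ y
injective⇒surjective {n} {f} f-inj y with any? (λ x → f x ≟ y)
... | yes found  = found
... | no  ¬found = ⊥-elim (ℕ.1+n≰n (injective⇒≤ extend-injective))
  where
  extend : Fin (suc n) → Fin n
  extend zero    = y
  extend (suc x) = f x

  extend-injective : Injective _≡_ _≡_ extend
  extend-injective {zero}  {zero}   _  = refl
  extend-injective {zero}  {suc x′} eq = ⊥-elim (¬found (x′ , sym eq))
  extend-injective {suc x} {zero}   eq = ⊥-elim (¬found (x , eq))
  extend-injective {suc x} {suc x′} eq = cong suc (f-inj eq)

-- If every value were attained, a choice of preimages would inject n + 1 elements into n. This will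
-- find the point of a ten-point hyperoval that the nine points of an oval leave out.
missed-value : ∀ {n} (f : Fin n → Fin (suc n)) → ∃[ h ] (∀ i → f i ≢ h)
missed-value {n} f with any? (λ h → all? (λ i → ¬? (f i ≟ h)))
... | yes found  = found
... | no  ¬found = ⊥-elim (ℕ.1+n≰n (injective⇒≤ section-injective))
  where
  preimage : ∀ h → ∃[ i ] f i ≡ h
  preimage h with any? (λ i → f i ≟ h)
  ... | yes found = found
  ... | no  none  = ⊥-elim (¬found (h , λ i eq → none (i , eq)))
  section-injective : Injective _≡_ _≡_ (λ h → proj₁ (preimage h))
  section-injective {h} {h′} eq =
    trans (sym (proj₂ (preimage h))) (trans (cong f eq) (proj₂ (preimage h′)))

encode : ∀ {n} → V n → Fin (2 ^ n)
encode []      = zero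
encode (b ∷ v) = combine (Inverse.from 2↔Bool b) (encode v)

decode : ∀ {n} → Fin (2 ^ n) → V n
decodePair : ∀ {n} → Fin 2 × Fin (2 ^ n) → V (suc n)

decode {zero}  _ = []
decode {suc n} i = decodePair (remQuot (2 ^ n) i)

decodePair (b , i) = Inverse.to 2↔Bool b ∷ decode i

decode-encode : ∀ {n} (v : V n) → decode (encode v) ≡ v
decode-encode []      = refl
decode-encode (b ∷ v) = trans
  (cong decodePair (remQuot-combine (Inverse.from 2↔Bool b) (encode v)))
  (cong₂ _∷_ (Inverse.strictlyInverseˡ 2↔Bool b) (decode-encode v))

encode-decode : ∀ {n} (i : Fin (2 ^ n)) → encode {n} (decode i) ≡ i
encode-decode {zero}  zero = refl
encode-decode {suc n} i = trans
  (cong₂ combine (Inverse.strictlyInverseʳ 2↔Bool (proj₁ (remQuot {2} (2 ^ n) i)))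
                 (encode-decode {n} (proj₂ (remQuot {2} (2 ^ n) i))))
  (combine-remQuot {2} (2 ^ n) i)

encode-injective : ∀ {n} {v w : V n} → encode v ≡ encode w → v ≡ w
encode-injective {v = v} {w} eq =
  trans (sym (decode-encode v)) (trans (cong decode eq) (decode-encode w))

decode-injective : ∀ {n} {i j : Fin (2 ^ n)} → decode {n} i ≡ decode j → i ≡ j
decode-injective {n} {i} {j} eq =
  trans (sym (encode-decode {n} i)) (trans (cong encode eq) (encode-decode {n} j))

abstract
  V-injective⇒surjective : ∀ {n} {f : V n → V n} → (∀ {x y} → f x ≡ f y → x ≡ y) →
                           ∀ y → ∃[ x ] f x ≡ y
  V-injective⇒surjective {n} {f} f-inj y
    with i , eq ← injective⇒surjective {f = λ i → encode (f (decode i))}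
                    (λ eq → decode-injective {n} (f-inj (encode-injective eq))) (encode y)
    = decode i , encode-injective eq

record Iso (n : ℕ) : Set where
  field
    to from     : V n → V n
    to-additive : Additive to
    to∘from     : ∀ y → to (from y) ≡ y
    from∘to     : ∀ x → from (to x) ≡ x

  to-injective : ∀ {x y} → to x ≡ to y → x ≡ y
  to-injective {x} {y} eq = trans (sym (from∘to x)) (trans (cong from eq) (from∘to y))

  to-zero : to 0V ≡ 0V
  to-zero = additive-zero to-additive

  kernel-zero : ∀ {x} → to x ≡ 0V → x ≡ 0V
  kernel-zero eq = to-injective (trans eq (sym to-zero))

open Iso public

inverse : ∀ {n} → Iso n → Iso n
inverse θ = record
  { to          = from θ
  ; from        = to θ
  ; to-additive = λ x y → to-injective θ (trans (to∘from θ _)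
      (sym (trans (to-additive θ _ _) (cong₂ _⊕_ (to∘from θ x) (to∘from θ y)))))
  ; to∘from     = from∘to θ
  ; from∘to     = to∘from θ
  }

infixr 9 _∘ᴵ_

_∘ᴵ_ : ∀ {n} → Iso n → Iso n → Iso n
θ ∘ᴵ η = record
  { to          = to θ ∘ to η
  ; from        = from η ∘ from θ
  ; to-additive = ∘-additive {g = to θ} (to-additive θ) (to-additive η)
  ; to∘from     = λ y → trans (cong (to θ) (to∘from η _)) (to∘from θ y)
  ; from∘to     = λ x → trans (cong (from η) (from∘to θ _)) (from∘to η x)
  }

-- Counting replaces rank theory: an injective map of the finite set `V n` to itself is onto.
iso-from-kernel : ∀ {n} (f : V n → V n) → Additive f → (∀ x → f x ≡ 0V → x ≡ 0V) → Iso n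
iso-from-kernel f f-add ker = record
  { to          = f
  ; from        = λ y → proj₁ (surj y)
  ; to-additive = f-add
  ; to∘from     = λ y → proj₂ (surj y)
  ; from∘to     = λ x → inj (proj₂ (surj (f x)))
  }
  where
  inj : ∀ {x y} → f x ≡ f y → x ≡ y
  inj = kernel-zero⇒injective f-add ker
  surj = V-injective⇒surjective inj

-- A right inverse s of f is injective, hence surjective, hence a two-sided inverse.
iso-from-surjection : ∀ {n} (f : V n → V n) → Additive f → (∀ y → ∃[ x ] f x ≡ y) → Iso n
iso-from-surjection f f-add surj = record
  { to          = f
  ; from        = s
  ; to-additive = f-add
  ; to∘from     = f∘s
  ; from∘to     = s∘f
  }
  where
  s = λ y → proj₁ (surj y)
  f∘s : ∀ y → f (s y) ≡ y
  f∘s y = proj₂ (surj y)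
  s-surjective = V-injective⇒surjective {f = s}
    (λ {x} {y} eq → trans (sym (f∘s x)) (trans (cong f eq) (f∘s y)))
  s∘f : ∀ x → s (f x) ≡ x
  s∘f x with y , refl ← s-surjective x = cong s (f∘s y)

-- Matrices of additive maps

functional : ∀ {n} → (V n → Bool) → V n
functional {zero}  g = []
functional {suc n} g = g (true ∷ 0V) ∷ functional (λ v → g (false ∷ v))

dot-functional : ∀ {n} (g : V n → Bool) → (∀ x y → g (x ⊕ y) ≡ g x xor g y) →
                 ∀ v → dot (functional g) v ≡ g v
dot-functional g g-add [] = sym (trans (g-add [] []) (xor-same (g [])))
dot-functional g g-add (b ∷ v) = trans
  (cong₂ _xor_ (head-term b) (dot-functional (λ v → g (false ∷ v)) (λ x y → g-add (false ∷ x) (false ∷ y)) v))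
  (trans (sym (g-add (b ∷ 0V) (false ∷ v)))
         (cong g (cong₂ _∷_ (xor-identityʳ b) (⊕-identityˡ v))))
  where
  head-term : ∀ b → g (true ∷ 0V) ∧ b ≡ g (b ∷ 0V)
  head-term true  = ∧-identityʳ _
  head-term false = trans (∧-zeroʳ _)
    (sym (trans (cong g (sym (⊕-self 0V))) (trans (g-add 0V 0V) (xor-same (g 0V)))))

matrix : (V9 → V9) → Matrix
matrix f = tabulate (λ j → functional (λ v → lookup (f v) j))

apply-matrix : ∀ {f} → Additive f → ∀ v → apply (matrix f) v ≡ f v
apply-matrix {f} f-add v = begin
  map (λ row → dot row v) (matrix f)
    ≡⟨ sym (tabulate-∘ (λ row → dot row v) (λ j → functional (λ w → lookup (f w) j))) ⟩
  tabulate (λ j → dot (functional (λ w → lookup (f w) j)) v)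
    ≡⟨ tabulate-cong (λ j → dot-functional (λ w → lookup (f w) j)
         (λ x y → trans (cong (λ u → lookup u j) (f-add x y)) (lookup-zipWith _xor_ j (f x) (f y))) v) ⟩
  tabulate (lookup (f v))
    ≡⟨ tabulate∘lookup (f v) ⟩
  f v ∎
  where open ≡-Reasoning

dot-⊕ : ∀ {n} (r x y : V n) → dot r (x ⊕ y) ≡ dot r x xor dot r y
dot-⊕ []      []      []      = refl
dot-⊕ (c ∷ r) (a ∷ x) (b ∷ y) = trans
  (cong₂ _xor_ (∧-distribˡ-xor c a b) (dot-⊕ r x y))
  (xor-interchange (c ∧ a) (c ∧ b) (dot r x) (dot r y))
  where
  xor-interchange : ∀ p q r s → (p xor q) xor (r xor s) ≡ (p xor r) xor (q xor s)
  -- The exchange law for bits is the one for vectors of length one.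
  xor-interchange p q r s = cong (λ { (b ∷ _) → b }) (⊕-interchange (p ∷ []) (q ∷ []) (r ∷ []) (s ∷ []))

apply-additive : ∀ M → Additive (apply M)
apply-additive M x y = go M
  where
  go : ∀ {n} (M : Vec (V 9) n) → map (λ row → dot row (x ⊕ y)) M ≡
       map (λ row → dot row x) M ⊕ map (λ row → dot row y) M
  go []      = refl
  go (r ∷ M) = cong₂ _∷_ (dot-⊕ r x y) (go M)

iso⇒invertible : (θ : Iso 9) → Invertible (matrix (to θ))
iso⇒invertible θ = matrix (from θ)
  , (λ v → trans (apply-matrix (to-additive (inverse θ)) _)
      (trans (cong (from θ) (apply-matrix (to-additive θ) v)) (from∘to θ v)))
  , (λ v → trans (apply-matrix (to-additive θ) _)
      (trans (cong (to θ) (apply-matrix (to-additive (inverse θ)) v)) (to∘from θ v)))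

-- The decomposition of GF(2)⁹ into three blocks

π₁ π₂ π₃ : V9 → V 3
π₁ (a ∷ b ∷ c ∷ _) = a ∷ b ∷ c ∷ []
π₂ (_ ∷ _ ∷ _ ∷ a ∷ b ∷ c ∷ _) = a ∷ b ∷ c ∷ []
π₃ (_ ∷ _ ∷ _ ∷ _ ∷ _ ∷ _ ∷ v) = v

π₁-additive : Additive π₁
π₁-additive (_ ∷ _ ∷ _ ∷ _) (_ ∷ _ ∷ _ ∷ _) = refl

π₂-additive : Additive π₂
π₂-additive (_ ∷ _ ∷ _ ∷ _ ∷ _ ∷ _ ∷ _) (_ ∷ _ ∷ _ ∷ _ ∷ _ ∷ _ ∷ _) = refl

π₃-additive : Additive π₃
π₃-additive (_ ∷ _ ∷ _ ∷ _ ∷ _ ∷ _ ∷ _) (_ ∷ _ ∷ _ ∷ _ ∷ _ ∷ _ ∷ _) = refl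

toV9-π : ∀ v → toV9 (π₁ v , π₂ v , π₃ v) ≡ v
toV9-π (_ ∷ _ ∷ _ ∷ _ ∷ _ ∷ _ ∷ _ ∷ _ ∷ _ ∷ []) = refl

π₁-toV9 : ∀ a b c → π₁ (toV9 (a , b , c)) ≡ a
π₁-toV9 (_ ∷ _ ∷ _ ∷ []) b c = refl

π₂-toV9 : ∀ a b c → π₂ (toV9 (a , b , c)) ≡ b
π₂-toV9 (_ ∷ _ ∷ _ ∷ []) (_ ∷ _ ∷ _ ∷ []) c = refl

π₃-toV9 : ∀ a b c → π₃ (toV9 (a , b , c)) ≡ c
π₃-toV9 (_ ∷ _ ∷ _ ∷ []) (_ ∷ _ ∷ _ ∷ []) c = refl

toV9-⊕ : ∀ a b c a′ b′ c′ →
         toV9 (a , b , c) ⊕ toV9 (a′ , b′ , c′) ≡ toV9 (a ⊕ a′ , b ⊕ b′ , c ⊕ c′)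
toV9-⊕ (_ ∷ _ ∷ _ ∷ []) (_ ∷ _ ∷ _ ∷ []) (_ ∷ _ ∷ _ ∷ [])
       (_ ∷ _ ∷ _ ∷ []) (_ ∷ _ ∷ _ ∷ []) (_ ∷ _ ∷ _ ∷ []) = refl

toV9-cong : ∀ {a b c a′ b′ c′} → a ≡ a′ → b ≡ b′ → c ≡ c′ → toV9 (a , b , c) ≡ toV9 (a′ , b′ , c′)
toV9-cong refl refl refl = refl

toV9-injective : ∀ {a b c a′ b′ c′} → toV9 (a , b , c) ≡ toV9 (a′ , b′ , c′) → a ≡ a′ × b ≡ b′ × c ≡ c′
toV9-injective {a} {b} {c} {a′} {b′} {c′} eq =
    trans (sym (π₁-toV9 a b c)) (trans (cong π₁ eq) (π₁-toV9 a′ b′ c′))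
  , trans (sym (π₂-toV9 a b c)) (trans (cong π₂ eq) (π₂-toV9 a′ b′ c′))
  , trans (sym (π₃-toV9 a b c)) (trans (cong π₃ eq) (π₃-toV9 a′ b′ c′))

blockMap : (f g h : V 3 → V 3) → V9 → V9
blockMap f g h v = toV9 (f (π₁ v) , g (π₂ v) , h (π₃ v))

blockMap-toV9 : ∀ f g h a b c → blockMap f g h (toV9 (a , b , c)) ≡ toV9 (f a , g b , h c)
blockMap-toV9 f g h a b c =
  toV9-cong (cong f (π₁-toV9 a b c)) (cong g (π₂-toV9 a b c)) (cong h (π₃-toV9 a b c))

blockᴵ : Iso 3 → Iso 3 → Iso 3 → Iso 9
blockᴵ α β γ = record
  { to          = blockMap (to α) (to β) (to γ)
  ; from        = blockMap (from α) (from β) (from γ)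
  ; to-additive = λ x y → trans
      (toV9-cong (∘-additive {g = to α} (to-additive α) π₁-additive x y)
                 (∘-additive {g = to β} (to-additive β) π₂-additive x y)
                 (∘-additive {g = to γ} (to-additive γ) π₃-additive x y))
      (sym (toV9-⊕ (to α (π₁ x)) (to β (π₂ x)) (to γ (π₃ x)) (to α (π₁ y)) (to β (π₂ y)) (to γ (π₃ y))))
  ; to∘from     = λ v → trans
      (blockMap-toV9 (to α) (to β) (to γ) (from α (π₁ v)) (from β (π₂ v)) (from γ (π₃ v)))
      (trans (toV9-cong (to∘from α _) (to∘from β _) (to∘from γ _)) (toV9-π v))
  ; from∘to     = λ v → trans
      (blockMap-toV9 (from α) (from β) (from γ) (to α (π₁ v)) (to β (π₂ v)) (to γ (π₃ v)))
      (trans (toV9-cong (from∘to α _) (from∘to β _) (from∘to γ _)) (toV9-π v))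
  }

-- Parametrised families of planes

combination : ∀ {n} → V n → V n → V n → V 3 → V n
combination u v w (a ∷ b ∷ c ∷ []) = scale a u ⊕ (scale b v ⊕ scale c w)

combination-additive : ∀ {n} (u v w : V n) → Additive (combination u v w)
combination-additive u v w (a ∷ b ∷ c ∷ []) (a′ ∷ b′ ∷ c′ ∷ []) = begin
  scale (a xor a′) u ⊕ (scale (b xor b′) v ⊕ scale (c xor c′) w)
    ≡⟨ cong₂ _⊕_ (scale-xor a a′ u) (cong₂ _⊕_ (scale-xor b b′ v) (scale-xor c c′ w)) ⟩
  (scale a u ⊕ scale a′ u) ⊕ ((scale b v ⊕ scale b′ v) ⊕ (scale c w ⊕ scale c′ w))
    ≡⟨ cong ((scale a u ⊕ scale a′ u) ⊕_) (⊕-interchange (scale b v) (scale b′ v) (scale c w) (scale c′ w)) ⟩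
  (scale a u ⊕ scale a′ u) ⊕ ((scale b v ⊕ scale c w) ⊕ (scale b′ v ⊕ scale c′ w))
    ≡⟨ ⊕-interchange (scale a u) (scale a′ u) (scale b v ⊕ scale c w) (scale b′ v ⊕ scale c′ w) ⟩
  (scale a u ⊕ (scale b v ⊕ scale c w)) ⊕ (scale a′ u ⊕ (scale b′ v ⊕ scale c′ w)) ∎
  where open ≡-Reasoning

-- With a vector of coefficients in place of a function on `Fin 3`, a plane is the image of an
-- additive map, and arguments about kernels apply to it.
span : Subspace → V 3 → V9
span S = combination (S zero) (S (suc zero)) (S (suc (suc zero)))

span-additive : ∀ S → Additive (span S)
span-additive S = combination-additive (S zero) (S (suc zero)) (S (suc (suc zero)))

∈S⇒span : ∀ S {v} → v ∈S S → ∃[ a ] v ≡ span S a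
∈S⇒span S (c , eq) = (c zero ∷ c (suc zero) ∷ c (suc (suc zero)) ∷ []) , eq

span⇒∈S : ∀ S {v} a → v ≡ span S a → v ∈S S
span⇒∈S S a@(_ ∷ _ ∷ _ ∷ []) eq = lookup a , eq

span-image : ∀ M S a → span (image M S) a ≡ apply M (span S a)
span-image M S (a ∷ b ∷ c ∷ []) = sym (trans (apply-additive M (scale a (S zero)) _) (cong₂ _⊕_
  (additive-scale (apply-additive M) a (S zero))
  (trans (apply-additive M (scale b (S (suc zero))) _) (cong₂ _⊕_
    (additive-scale (apply-additive M) b (S (suc zero)))
    (additive-scale (apply-additive M) c (S (suc (suc zero))))))))

-- Each plane carries a parametrisation, so that a change of coordinates is an equation between maps
-- rather than an equality of subspaces.
Planes : Set
Planes = Fin 9 → V 3 → V9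

planes : Family → Planes
planes O i = span (O i)

Independent : Planes → Set
Independent S = ∀ {i j k} → i ≢ j → j ≢ k → i ≢ k →
  ∀ a b c → S i a ⊕ (S j b ⊕ S k c) ≡ 0V → a ≡ 0V × b ≡ 0V × c ≡ 0V

sum₃ : Planes → (i j k : Fin 9) → V9 → V9
sum₃ S i j k v = S i (π₁ v) ⊕ (S j (π₂ v) ⊕ S k (π₃ v))

sum₃-toV9 : ∀ S i j k a b c → sum₃ S i j k (toV9 (a , b , c)) ≡ S i a ⊕ (S j b ⊕ S k c)
sum₃-toV9 S i j k a b c =
  cong₂ _⊕_ (cong (S i) (π₁-toV9 a b c)) (cong₂ _⊕_ (cong (S j) (π₂-toV9 a b c)) (cong (S k) (π₃-toV9 a b c)))

sum₃-additive : ∀ {S} → (∀ i → Additive (S i)) → ∀ i j k → Additive (sum₃ S i j k)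
sum₃-additive {S} S-add i j k =
  ⊕-additive (∘-additive {g = S i} (S-add i) π₁-additive)
    (⊕-additive (∘-additive {g = S j} (S-add j) π₂-additive) (∘-additive {g = S k} (S-add k) π₃-additive))

independent⇒iso : ∀ {S} → (∀ i → Additive (S i)) → Independent S →
                  ∀ {i j k} → i ≢ j → j ≢ k → i ≢ k → Iso 9
independent⇒iso {S} S-add ind {i} {j} {k} i≢j j≢k i≢k =
  iso-from-kernel (sum₃ S i j k) (sum₃-additive S-add i j k) ker
  where
  ker : ∀ v → sum₃ S i j k v ≡ 0V → v ≡ 0V
  ker v eq with a≡0 , b≡0 , c≡0 ← ind i≢j j≢k i≢k (π₁ v) (π₂ v) (π₃ v) eq =
    trans (sym (toV9-π v)) (toV9-cong a≡0 b≡0 c≡0)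

-- The sum map of three planes goes from dimension 9 to dimension 9; being onto, it is injective.
pseudoOval⇒independent : ∀ {O} → IsPseudoOval O → Independent (planes O)
pseudoOval⇒independent {O} oval {i} {j} {k} i≢j j≢k i≢k a b c eq =
  toV9-injective (kernel-zero φ (trans (sum₃-toV9 (planes O) i j k a b c) eq))
  where
  surj : ∀ v → ∃[ x ] sum₃ (planes O) i j k x ≡ v
  surj v with _ , _ , _ , x∈ , y∈ , z∈ , refl ← oval i j k i≢j j≢k i≢k v
            with a , refl ← ∈S⇒span (O i) x∈ | b , refl ← ∈S⇒span (O j) y∈ | c , refl ← ∈S⇒span (O k) z∈ =
    toV9 (a , b , c) , sum₃-toV9 (planes O) i j k a b c
  φ : Iso 9
  φ = iso-from-surjection (sum₃ (planes O) i j k) (sum₃-additive (λ i → span-additive (O i)) i j k) surj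

independent⇒pseudoOval : ∀ {O} → Independent (planes O) → IsPseudoOval O
independent⇒pseudoOval {O} ind i j k i≢j j≢k i≢k v =
    span (O i) (π₁ w) , span (O j) (π₂ w) , span (O k) (π₃ w)
  , span⇒∈S (O i) (π₁ w) refl , span⇒∈S (O j) (π₂ w) refl , span⇒∈S (O k) (π₃ w) refl , sym (to∘from φ v)
  where
  φ = independent⇒iso (λ i → span-additive (O i)) ind i≢j j≢k i≢k
  w = from φ v

infix 4 _≅_ _↝_

-- `≅` keeps the labels of the planes and therefore transports the independence of triples; `↝` also
-- allows new labels, as `Equivalent` does.
_≅_ : Planes → Planes → Set
S ≅ T = Σ (Iso 9) λ θ → ∀ i → Σ (Iso 3) λ r → ∀ x → to θ (S i x) ≡ T i (to r x)

_↝_ : Planes → Planes → Set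
S ↝ T = Σ (Iso 9) λ θ → ∀ i → Σ (Fin 9) λ j → Σ (Iso 3) λ r → ∀ x → to θ (S i x) ≡ T j (to r x)

≅-trans : ∀ {S T U} → S ≅ T → T ≅ U → S ≅ U
≅-trans (θ , S→T) (η , T→U) = (η ∘ᴵ θ) , λ i →
  let r , θS≡T = S→T i ; s , ηT≡U = T→U i in
  (s ∘ᴵ r) , λ x → trans (cong (to η) (θS≡T x)) (ηT≡U (to r x))

≅-↝-trans : ∀ {S T U} → S ≅ T → T ↝ U → S ↝ U
≅-↝-trans (θ , S→T) (η , T→U) = (η ∘ᴵ θ) , λ i →
  let r , θS≡T = S→T i ; j , s , ηT≡U = T→U i in
  j , (s ∘ᴵ r) , λ x → trans (cong (to η) (θS≡T x)) (ηT≡U (to r x))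

≅-independent : ∀ {S T} → S ≅ T → Independent S → Independent T
≅-independent {S} {T} (θ , S→T) ind {i} {j} {k} i≢j j≢k i≢k a b c eq =
  let a′≡0 , b′≡0 , c′≡0 = ind i≢j j≢k i≢k (pull i a) (pull j b) (pull k c) (kernel-zero θ (trans push eq))
  in unpull i a′≡0 , unpull j b′≡0 , unpull k c′≡0
  where
  open ≡-Reasoning
  r : Fin 9 → Iso 3
  r i = proj₁ (S→T i)
  pull : Fin 9 → V 3 → V 3
  pull i = from (r i)
  unpull : ∀ i {a} → pull i a ≡ 0V → a ≡ 0V
  unpull i eq = kernel-zero (inverse (r i)) eq
  θ-pull : ∀ i a → to θ (S i (pull i a)) ≡ T i a
  θ-pull i a = trans (proj₂ (S→T i) (pull i a)) (cong (T i) (to∘from (r i) a))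
  push : to θ (S i (pull i a) ⊕ (S j (pull j b) ⊕ S k (pull k c))) ≡ T i a ⊕ (T j b ⊕ T k c)
  push = begin
    to θ (S i (pull i a) ⊕ (S j (pull j b) ⊕ S k (pull k c)))
      ≡⟨ trans (to-additive θ _ _) (cong (to θ (S i (pull i a)) ⊕_) (to-additive θ _ _)) ⟩
    to θ (S i (pull i a)) ⊕ (to θ (S j (pull j b)) ⊕ to θ (S k (pull k c)))
      ≡⟨ cong₂ _⊕_ (θ-pull i a) (cong₂ _⊕_ (θ-pull j b) (θ-pull k c)) ⟩
    T i a ⊕ (T j b ⊕ T k c) ∎

↝⇒Equivalent : ∀ {O O′} → planes O ↝ planes O′ → Equivalent O O′
↝⇒Equivalent {O} {O′} (θ , O→O′) = M , iso⇒invertible θ , λ i →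
  let j , r , θO≡O′ = O→O′ i in
  j , λ v →
    (λ v∈ → let a , eq = ∈S⇒span (image M (O i)) v∈ in
       span⇒∈S (O′ j) (to r a) (trans eq (trans (image-span i a) (θO≡O′ a))))
  , (λ v∈ → let b , eq = ∈S⇒span (O′ j) v∈ in
       span⇒∈S (image M (O i)) (from r b) (trans eq (sym (trans (image-span i (from r b))
         (trans (θO≡O′ (from r b)) (cong (span (O′ j)) (to∘from r b)))))))
  where
  M = matrix (to θ)
  image-span : ∀ i a → span (image M (O i)) a ≡ to θ (span (O i) a)
  image-span i a = trans (span-image M (O i) a) (apply-matrix (to-additive θ) (span (O i) a))

-- Coordinates adapted to four planes of the family

graphs : (P Q : Fin 6 → Iso 3) → Planes
graphs P Q zero                y = toV9 (y , 0V , 0V)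
graphs P Q (suc zero)          y = toV9 (0V , y , 0V)
graphs P Q (suc (suc zero))    y = toV9 (0V , 0V , y)
graphs P Q (suc (suc (suc k))) y = toV9 (y , to (P k) y , to (Q k) y)

affine : Fin 6 → Fin 9
affine k = suc (suc (suc k))

module Normalise {S : Planes} (S-add : ∀ i → Additive (S i)) (ind : Independent S) where

  private
    i₀ i₁ i₂ : Fin 9
    i₀ = zero
    i₁ = suc zero
    i₂ = suc (suc zero)

    S-zero : ∀ i → S i 0V ≡ 0V
    S-zero i = additive-zero (S-add i)

    Φ Ψ : Iso 9
    Φ = independent⇒iso S-add ind {i₀} {i₁} {i₂} (λ ()) (λ ()) (λ ())
    Ψ = inverse Φ

    coords : ∀ w → w ≡ S i₀ (π₁ (to Ψ w)) ⊕ (S i₁ (π₂ (to Ψ w)) ⊕ S i₂ (π₃ (to Ψ w)))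
    coords w = sym (to∘from Φ w)

    Ψ-sum : ∀ a b c → to Ψ (S i₀ a ⊕ (S i₁ b ⊕ S i₂ c)) ≡ toV9 (a , b , c)
    Ψ-sum a b c = trans (cong (from Φ) (sym (sum₃-toV9 S i₀ i₁ i₂ a b c))) (from∘to Φ _)

    coordinate : (V9 → V 3) → Fin 6 → V 3 → V 3
    coordinate π k x = π (to Ψ (S (affine k) x))

    coordinate-additive : ∀ {π} → Additive π → ∀ k → Additive (coordinate π k)
    coordinate-additive {π} π-add k =
      ∘-additive {g = π} π-add (∘-additive {g = to Ψ} (to-additive Ψ) (S-add (affine k)))

    drop₁ : ∀ {w x y z : V9} → w ≡ x ⊕ (y ⊕ z) → x ≡ 0V → w ⊕ (y ⊕ z) ≡ 0V
    drop₁ eq refl = ≡⇒⊕-zero (trans eq (⊕-identityˡ _))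

    drop₂ : ∀ {w x y z : V9} → w ≡ x ⊕ (y ⊕ z) → y ≡ 0V → w ⊕ (x ⊕ z) ≡ 0V
    drop₂ {x = x} eq refl = ≡⇒⊕-zero (trans eq (cong (x ⊕_) (⊕-identityˡ _)))

    drop₃ : ∀ {w x y z : V9} → w ≡ x ⊕ (y ⊕ z) → z ≡ 0V → w ⊕ (x ⊕ y) ≡ 0V
    drop₃ {x = x} eq refl = ≡⇒⊕-zero (trans eq (cong (x ⊕_) (⊕-identityʳ _)))

    S-vanish : ∀ i {a} → a ≡ 0V → S i a ≡ 0V
    S-vanish i refl = S-zero i

    -- If one block coordinate of a vector in an affine plane vanishes, the vector lies in the sum
    -- of the other two coordinate planes, and independence of these three planes makes it zero. So
    -- each block coordinate is a bijection on the plane.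
    A B C : Fin 6 → Iso 3
    A k = iso-from-kernel (coordinate π₁ k) (coordinate-additive π₁-additive k) λ x eq →
      proj₁ (ind {affine k} {i₁} {i₂} (λ ()) (λ ()) (λ ()) x
        (coordinate π₂ k x) (coordinate π₃ k x) (drop₁ (coords _) (S-vanish i₀ eq)))
    B k = iso-from-kernel (coordinate π₂ k) (coordinate-additive π₂-additive k) λ x eq →
      proj₁ (ind {affine k} {i₀} {i₂} (λ ()) (λ ()) (λ ()) x
        (coordinate π₁ k x) (coordinate π₃ k x)
        (drop₂ {x = S i₀ (coordinate π₁ k x)} (coords _) (S-vanish i₁ eq)))
    C k = iso-from-kernel (coordinate π₃ k) (coordinate-additive π₃-additive k) λ x eq →
      proj₁ (ind {affine k} {i₀} {i₁} (λ ()) (λ ()) (λ ()) x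
        (coordinate π₁ k x) (coordinate π₂ k x)
        (drop₃ {x = S i₀ (coordinate π₁ k x)} (coords _) (S-vanish i₂ eq)))

    -- The block scaling that moves the fourth plane to the diagonal {(x, x, x)}.
    A₀⁻¹ B₀⁻¹ C₀⁻¹ : Iso 3
    A₀⁻¹ = inverse (A zero)
    B₀⁻¹ = inverse (B zero)
    C₀⁻¹ = inverse (C zero)

    θ : Iso 9
    θ = blockᴵ A₀⁻¹ B₀⁻¹ C₀⁻¹ ∘ᴵ Ψ

    θ-sum : ∀ a b c → to θ (S i₀ a ⊕ (S i₁ b ⊕ S i₂ c)) ≡ toV9 (to A₀⁻¹ a , to B₀⁻¹ b , to C₀⁻¹ c)
    θ-sum a b c = trans (cong (blockMap (to A₀⁻¹) (to B₀⁻¹) (to C₀⁻¹)) (Ψ-sum a b c))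
                        (blockMap-toV9 (to A₀⁻¹) (to B₀⁻¹) (to C₀⁻¹) a b c)

    -- Parametrising a plane by its own first block, after the scaling, turns it into a graph.
    r : Fin 6 → Iso 3
    r k = A₀⁻¹ ∘ᴵ A k

  P Q : Fin 6 → Iso 3
  P k = (B₀⁻¹ ∘ᴵ B k) ∘ᴵ inverse (r k)
  Q k = (C₀⁻¹ ∘ᴵ C k) ∘ᴵ inverse (r k)

  P-zero : ∀ y → to (P zero) y ≡ y
  P-zero y = trans (cong (to B₀⁻¹ ∘ to (B zero)) (from∘to (A zero) y)) (from∘to (B zero) y)

  Q-zero : ∀ y → to (Q zero) y ≡ y
  Q-zero y = trans (cong (to C₀⁻¹ ∘ to (C zero)) (from∘to (A zero) y)) (from∘to (C zero) y)

  normal-form : S ≅ graphs P Q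
  normal-form = θ , λ
    { zero → A₀⁻¹ , λ x → trans (cong (to θ) (expand₀ x))
        (trans (θ-sum x 0V 0V) (toV9-cong refl (to-zero B₀⁻¹) (to-zero C₀⁻¹)))
    ; (suc zero) → B₀⁻¹ , λ x → trans (cong (to θ) (expand₁ x))
        (trans (θ-sum 0V x 0V) (toV9-cong (to-zero A₀⁻¹) refl (to-zero C₀⁻¹)))
    ; (suc (suc zero)) → C₀⁻¹ , λ x → trans (cong (to θ) (expand₂ x))
        (trans (θ-sum 0V 0V x) (toV9-cong (to-zero A₀⁻¹) (to-zero B₀⁻¹) refl))
    ; (suc (suc (suc k))) → r k , λ x → toV9-cong {a = to (r k) x} refl
        (cong (to B₀⁻¹ ∘ to (B k)) (sym (from∘to (r k) x)))
        (cong (to C₀⁻¹ ∘ to (C k)) (sym (from∘to (r k) x)))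
    }
    where
    expand₀ : ∀ x → S i₀ x ≡ S i₀ x ⊕ (S i₁ 0V ⊕ S i₂ 0V)
    expand₀ x = sym (trans (cong₂ (λ u v → S i₀ x ⊕ (u ⊕ v)) (S-zero i₁) (S-zero i₂)) (⊕-identityʳ _))
    expand₁ : ∀ x → S i₁ x ≡ S i₀ 0V ⊕ (S i₁ x ⊕ S i₂ 0V)
    expand₁ x = sym (trans (cong₂ (λ u v → u ⊕ (S i₁ x ⊕ v)) (S-zero i₀) (S-zero i₂))
                    (trans (⊕-identityˡ _) (⊕-identityʳ _)))
    expand₂ : ∀ x → S i₂ x ≡ S i₀ 0V ⊕ (S i₁ 0V ⊕ S i₂ x)
    expand₂ x = sym (trans (cong₂ (λ u v → u ⊕ (v ⊕ S i₂ x)) (S-zero i₀) (S-zero i₁))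
                    (trans (⊕-identityˡ _) (⊕-identityˡ _)))

module GraphConditions {P Q : Fin 6 → Iso 3} (ind : Independent (graphs P Q))
                       {k l : Fin 6} (k≢l : k ≢ l) where

  private
    affine-≢ : affine k ≢ affine l
    affine-≢ refl = k≢l refl

    graphs-sum : ∀ a b c y y′ → a ⊕ (y ⊕ y′) ≡ 0V → b ⊕ (to (P k) y ⊕ to (P l) y′) ≡ 0V →
      c ⊕ (to (Q k) y ⊕ to (Q l) y′) ≡ 0V →
      toV9 (a , b , c) ⊕ (graphs P Q (affine k) y ⊕ graphs P Q (affine l) y′) ≡ 0V
    graphs-sum a b c y y′ ea eb ec = trans
      (cong (toV9 (a , b , c) ⊕_) (toV9-⊕ y (to (P k) y) (to (Q k) y) y′ (to (P l) y′) (to (Q l) y′)))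
      (trans (toV9-⊕ a b c _ _ _) (toV9-cong ea eb ec))

    0⊕ : ∀ {x y : V 3} → x ≡ y → 0V ⊕ (x ⊕ y) ≡ 0V
    0⊕ eq = trans (⊕-identityˡ _) (≡⇒⊕-zero eq)

  -- The difference of the two graph vectors over `y` then has only a third block, so it lies in the
  -- third coordinate plane, and the independence of the three planes applies.
  P-distinct : ∀ y → to (P k) y ≡ to (P l) y → y ≡ 0V
  P-distinct y eq = proj₁ (proj₂ (ind {suc (suc zero)} {affine k} {affine l} (λ ()) affine-≢ (λ ())
    (to (Q k) y ⊕ to (Q l) y) y y
    (graphs-sum 0V 0V _ y y (0⊕ refl) (0⊕ eq) (⊕-self _))))

  Q-distinct : ∀ y → to (Q k) y ≡ to (Q l) y → y ≡ 0V
  Q-distinct y eq = proj₁ (proj₂ (ind {suc zero} {affine k} {affine l} (λ ()) affine-≢ (λ ())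
    (to (P k) y ⊕ to (P l) y) y y
    (graphs-sum 0V _ 0V y y (0⊕ refl) (⊕-self _) (0⊕ eq))))

  PQ-distinct : ∀ y y′ → to (P k) y ≡ to (P l) y′ → to (Q k) y ≡ to (Q l) y′ → y ≡ 0V
  PQ-distinct y y′ eqP eqQ = proj₁ (proj₂ (ind {zero} {affine k} {affine l} (λ ()) affine-≢ (λ ())
    (y ⊕ y′) y y′
    (graphs-sum _ 0V 0V y y′ (⊕-self _) (0⊕ eqP) (0⊕ eqQ))))

  -- Seen from the first coordinate plane, a graph is parametrised by its second block `u`, over
  -- which its third block is `QP⁻¹ u`; this is why the two preimages of `u` may differ.
  R-distinct : ∀ u → to (Q k) (from (P k) u) ≡ to (Q l) (from (P l) u) → u ≡ 0V
  R-distinct u eq = kernel-zero (inverse (P k))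
    (PQ-distinct (from (P k) u) (from (P l) u) (trans (to∘from (P k) u) (sym (to∘from (P l) u))) eq)

-- Verification by enumeration

vectors : ∀ n → List (V n)
vectors zero    = [] ∷ []
vectors (suc n) = List.map (false ∷_) (vectors n) List.++ List.map (true ∷_) (vectors n)

∈-vectors : ∀ {n} (v : V n) → v ∈ vectors n
∈-vectors []          = here refl
∈-vectors (false ∷ v) = ∈-++⁺ˡ (∈-map⁺ (false ∷_) (∈-vectors v))
∈-vectors (true ∷ v)  = ∈-++⁺ʳ _ (∈-map⁺ (true ∷_) (∈-vectors v))

infixr 4 _⇒_

_⇒_ : Bool → Bool → Bool
true  ⇒ b = b
false ⇒ b = true

T-⇒ : ∀ {a b} → T (a ⇒ b) → T a → T b
T-⇒ {true} t _ = t

⇒-T : ∀ {a b} → (T a → T b) → T (a ⇒ b)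
⇒-T {true}  f = f tt
⇒-T {false} f = tt

T⇒true : ∀ {a} → T a → a ≡ true
T⇒true {true} _ = refl

T-∨⁻ : ∀ {a b} → T (a ∨ b) → T a ⊎ T b
T-∨⁻ {true}  t = inj₁ t
T-∨⁻ {false} t = inj₂ t

T-not : ∀ {a} → T (not a) → ¬ T a
T-not {false} _ ()

T-not⁺ : ∀ {a} → ¬ T a → T (not a)
T-not⁺ {true}  ¬t = ¬t tt
T-not⁺ {false} ¬t = tt

T-∧⁻ : ∀ {a b} → T (a ∧ b) → T a × T b
T-∧⁻ {true} t = tt , t

T-∧⁺ : ∀ {a b} → T a → T b → T (a ∧ b)
T-∧⁺ {true} _ t = t

module _ {A : Set} (p : A → Bool) where

  all-elim : ∀ {xs x} → all p xs ≡ true → x ∈ xs → T (p x)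
  all-elim {y ∷ _} eq (here refl) with p y
  ... | true = tt
  all-elim {y ∷ _} eq (there x∈) with p y
  ... | true = all-elim eq x∈

  all-intro : (∀ x → T (p x)) → ∀ xs → T (all p xs)
  all-intro h []       = tt
  all-intro h (x ∷ xs) = T-∧⁺ (h x) (all-intro h xs)

  any-elim : ∀ {xs} → T (any p xs) → ∃[ x ] (x ∈ xs × T (p x))
  any-elim {x ∷ xs} t with p x in eq
  ... | true  = x , here refl , subst T (sym eq) tt
  ... | false with y , y∈ , py ← any-elim {xs} t = y , there y∈ , py

  ∈-filterᵇ : ∀ {xs x} → x ∈ xs → T (p x) → x ∈ filterᵇ p xs
  ∈-filterᵇ = ∈-filter⁺ (T? ∘ p)

isZero : ∀ {n} → V n → Bool
isZero []          = true
isZero (true ∷ v)  = false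
isZero (false ∷ v) = isZero v

isZero-sound : ∀ {n} {v : V n} → T (isZero v) → v ≡ 0V
isZero-sound {v = []}        _ = refl
isZero-sound {v = false ∷ v} t = cong (false ∷_) (isZero-sound t)

isZero-complete : ∀ {n} {v : V n} → v ≡ 0V → T (isZero v)
isZero-complete {zero}  refl = tt
isZero-complete {suc n} refl = isZero-complete {n} refl

infix 5 _==_

_==_ : ∀ {n} → V n → V n → Bool
[]          == []          = true
(true ∷ v)  == (true ∷ w)  = v == w
(false ∷ v) == (false ∷ w) = v == w
(true ∷ v)  == (false ∷ w) = false
(false ∷ v) == (true ∷ w)  = false

==-sound : ∀ {n} {v w : V n} → T (v == w) → v ≡ w
==-sound {v = []}        {[]}        _ = refl
==-sound {v = true ∷ v}  {true ∷ w}  t = cong (true ∷_) (==-sound t)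
==-sound {v = false ∷ v} {false ∷ w} t = cong (false ∷_) (==-sound t)

==-refl : ∀ {n} (v : V n) → T (v == v)
==-refl []          = tt
==-refl (true ∷ v)  = ==-refl v
==-refl (false ∷ v) = ==-refl v

==-complete : ∀ {n} {v w : V n} → v ≡ w → T (v == w)
==-complete {v = v} refl = ==-refl v

≢⇒T-not : ∀ {n} {v w : V n} → v ≢ w → T (not (v == w))
≢⇒T-not {v = v} {w} v≢w = T-not⁺ {v == w} (v≢w ∘ ==-sound)

-- 3 × 3 matrices over GF(2), stored by columns

e₁ e₂ e₃ : V 3
e₁ = true ∷ false ∷ false ∷ []
e₂ = false ∷ true ∷ false ∷ []
e₃ = false ∷ false ∷ true ∷ []

act : V9 → V 3 → V 3
act M = combination (π₁ M) (π₂ M) (π₃ M)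

columns : (V 3 → V 3) → V9
columns f = toV9 (f e₁ , f e₂ , f e₃)

I₃ : V9
I₃ = columns (λ x → x)

_·_ : V9 → V9 → V9
M · N = columns (λ x → act M (act N x))

isInjective : V9 → Bool
isInjective M = all (λ x → isZero (act M x) ⇒ isZero x) (vectors 3)

det₂ : V9 → Bool
det₂ (a ∷ b ∷ c ∷ d ∷ e ∷ f ∷ g ∷ h ∷ i ∷ []) =
  (a ∧ ((e ∧ i) xor (f ∧ h))) xor ((b ∧ ((d ∧ i) xor (f ∧ g))) xor (c ∧ ((d ∧ h) xor (e ∧ g))))

-- The searches test a great many sums for invertibility. The determinant is a single Boolean
-- expression and stands in for the search for a kernel vector, which is made only here, once for
-- each of the 512 matrices.
injective⇒det₂ : ∀ M → T (isInjective M) → T (det₂ M)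
injective⇒det₂ M = T-⇒ (all-elim (λ M → isInjective M ⇒ det₂ M) checked (∈-vectors M))
  where
  checked : all (λ M → isInjective M ⇒ det₂ M) (vectors 9) ≡ true
  checked = refl

apart : V9 → V9 → Bool
apart M N = det₂ (M ⊕ N)

commutes : V9 → V9 → Bool
commutes M N = M · N == N · M

fixedPointFree : V9 → Bool
fixedPointFree M = det₂ M ∧ apart M I₃

fixedPointFrees : List V9
fixedPointFrees = filterᵇ fixedPointFree (vectors 9)

∈-fixedPointFrees : ∀ P → T (fixedPointFree P) → P ∈ fixedPointFrees
∈-fixedPointFrees P = ∈-filterᵇ fixedPointFree (∈-vectors P)

module Triples where
  row : V9 → List V9 → Bool
  row P Ns = all (λ Q → commutes P Q ∨ all (λ R → not (apart Q R)) Ns) Ns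

  check : List V9 → Bool
  check Ps = all (λ P → row P (filterᵇ (apart P) Ps)) Ps

  -- The projective plane of order 8 is unique, hence Desarguesian, so a full spread set containing
  -- 0 and 1 is a field. The search shows that three further members are already forced to commute.
  sound : ∀ {Ps P Q R} → check Ps ≡ true → P ∈ Ps → Q ∈ Ps → R ∈ Ps →
          T (apart P Q) → T (apart P R) → T (apart Q R) → T (commutes P Q)
  sound {Ps} {P} {Q} {R} ok P∈ Q∈ R∈ PQ PR QR
    with T-∨⁻ {commutes P Q} (all-elim (λ Q → commutes P Q ∨ all (λ R → not (apart Q R)) Ns)
           (T⇒true (all-elim (λ P → row P (filterᵇ (apart P) Ps)) ok P∈)) (∈-filterᵇ (apart P) Q∈ PQ))
    where
    Ns : List V9
    Ns = filterᵇ (apart P) Ps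
  ... | inj₁ comm = comm
  ... | inj₂ none = ⊥-elim (T-not (all-elim (λ R → not (apart Q R)) (T⇒true none)
                     (∈-filterᵇ (apart P) R∈ PR)) QR)

  checked : check fixedPointFrees ≡ true
  checked = refl

module Pairs where
  -- The centralizer of a candidate is its field, so within `fixedPointFrees` a candidate has just
  -- five partners: the field elements other than 0, 1 and itself. This bounds the search over two
  -- graphs by 48² · 5² cases.
  partners : List V9 → V9 → List V9
  partners Ps P = filterᵇ (λ P′ → apart P P′ ∧ commutes P P′) Ps

  table : List V9 → List (V9 × List V9)
  table Ps = List.map (λ P → P , partners Ps P) Ps

  test : V9 → V9 → V9 → Bool
  test P Q Q′ = fixedPointFree Q′ ⇒ apart Q Q′ ⇒ commutes Q Q′ ⇒ commutes P Q ∧ commutes P Q′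

  inner : V9 → V9 → List V9 → List V9 → Bool
  inner P Q P′s R′s = fixedPointFree Q ⇒ all (λ P′ → all (λ R′ → test P Q (R′ · P′)) R′s) P′s

  outer : List (V9 × List V9) → V9 × List V9 → Bool
  outer Ps (P , P′s) = all (λ (R , R′s) → inner P (R · P) P′s R′s) Ps

  check : List (V9 × List V9) → Bool
  check Ps = all (outer Ps) Ps

  -- Enumerating `P` and `R = QP⁻¹` produces `Q` as the product `R · P`, so no matrix has to be
  -- inverted in the search.
  sound : ∀ {Ps P R P′ R′} → check (table Ps) ≡ true → P ∈ Ps → R ∈ Ps → P′ ∈ Ps → R′ ∈ Ps →
    T (fixedPointFree (R · P)) → T (fixedPointFree (R′ · P′)) →
    T (apart P P′) → T (apart R R′) → T (apart (R · P) (R′ · P′)) →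
    T (commutes P P′) → T (commutes R R′) → T (commutes (R · P) (R′ · P′)) →
    T (commutes P (R · P)) × T (commutes P (R′ · P′))
  sound {Ps} {P} {R} {P′} {R′} ok P∈ R∈ P′∈ R′∈ fQ fQ′ aP aR aQ cP cR cQ =
    T-∧⁻ (T-⇒ (T-⇒ (T-⇒ tested fQ′) aQ) cQ)
    where
    P-partner : P′ ∈ partners Ps P
    P-partner = ∈-filterᵇ (λ P′ → apart P P′ ∧ commutes P P′) P′∈ (T-∧⁺ aP cP)
    R-partner : R′ ∈ partners Ps R
    R-partner = ∈-filterᵇ (λ R′ → apart R R′ ∧ commutes R R′) R′∈ (T-∧⁺ aR cR)
    row : T (outer (table Ps) (P , partners Ps P))
    row = all-elim (outer (table Ps)) ok (∈-map⁺ (λ P → P , partners Ps P) P∈)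
    cell : T (inner P (R · P) (partners Ps P) (partners Ps R))
    cell = all-elim (λ (R , R′s) → inner P (R · P) (partners Ps P) R′s)
      (T⇒true row) (∈-map⁺ (λ P → P , partners Ps P) R∈)
    tested : T (test P (R · P) (R′ · P′))
    tested = all-elim (λ R′ → test P (R · P) (R′ · P′)) (T⇒true
      (all-elim (λ P′ → all (λ R′ → test P (R · P) (R′ · P′)) (partners Ps R))
        (T⇒true (T-⇒ cell fQ)) P-partner)) R-partner

  checked : check (table fixedPointFrees) ≡ true
  checked = refl

scale-basis : ∀ a b c → (a ∷ b ∷ c ∷ []) ≡ scale a e₁ ⊕ (scale b e₂ ⊕ scale c e₃)
scale-basis false false false = refl
scale-basis false false true  = refl
scale-basis false true  false = refl
scale-basis false true  true  = refl
scale-basis true  false false = refl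
scale-basis true  false true  = refl
scale-basis true  true  false = refl
scale-basis true  true  true  = refl

additive-basis : ∀ {n} {f : V 3 → V n} → Additive f → ∀ x → f x ≡ combination (f e₁) (f e₂) (f e₃) x
additive-basis {f = f} f-add (a ∷ b ∷ c ∷ []) = trans (cong f (scale-basis a b c))
  (trans (f-add _ _) (cong₂ _⊕_ (additive-scale f-add a e₁)
    (trans (f-add _ _) (cong₂ _⊕_ (additive-scale f-add b e₂) (additive-scale f-add c e₃)))))

combination-cong : ∀ {n} {u u′ v v′ w w′ : V n} → u ≡ u′ → v ≡ v′ → w ≡ w′ →
                   ∀ x → combination u v w x ≡ combination u′ v′ w′ x
combination-cong refl refl refl x = refl

act-columns : ∀ {f} → Additive f → ∀ x → act (columns f) x ≡ f x
act-columns {f} f-add x = trans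
  (combination-cong (π₁-toV9 (f e₁) (f e₂) (f e₃)) (π₂-toV9 (f e₁) (f e₂) (f e₃))
                    (π₃-toV9 (f e₁) (f e₂) (f e₃)) x)
  (sym (additive-basis f-add x))

act-additive : ∀ M → Additive (act M)
act-additive M = combination-additive (π₁ M) (π₂ M) (π₃ M)

columns-cong : ∀ {f g : V 3 → V 3} → (∀ x → f x ≡ g x) → columns f ≡ columns g
columns-cong f≗g = toV9-cong (f≗g e₁) (f≗g e₂) (f≗g e₃)

columns-· : ∀ {f g} → Additive f → Additive g → columns f · columns g ≡ columns (λ x → f (g x))
columns-· {f} {g} f-add g-add =
  columns-cong (λ x → trans (act-columns f-add _) (cong f (act-columns g-add x)))

Commute : (f g : V 3 → V 3) → Set
Commute f g = ∀ x → f (g x) ≡ g (f x)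

commutes-sound : ∀ {f g} → Additive f → Additive g → T (commutes (columns f) (columns g)) → Commute f g
commutes-sound {f} {g} f-add g-add t x = begin
  f (g x)                          ≡⟨ sym (act-columns (∘-additive {g = f} f-add g-add) x) ⟩
  act (columns (λ x → f (g x))) x  ≡⟨ cong (λ M → act M x) matrices ⟩
  act (columns (λ x → g (f x))) x  ≡⟨ act-columns (∘-additive {g = g} g-add f-add) x ⟩
  g (f x)                          ∎
  where
  open ≡-Reasoning
  matrices : columns (λ x → f (g x)) ≡ columns (λ x → g (f x))
  matrices = trans (sym (columns-· f-add g-add)) (trans (==-sound t) (columns-· g-add f-add))

det₂-columns : ∀ {f} → Additive f → (∀ x → f x ≡ 0V → x ≡ 0V) → T (det₂ (columns f))
det₂-columns {f} f-add ker = injective⇒det₂ (columns f)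
  (all-intro (λ x → isZero (act (columns f) x) ⇒ isZero x) (λ x → ⇒-T (λ t →
    isZero-complete (ker x (trans (sym (act-columns f-add x)) (isZero-sound t))))) (vectors 3))

apart-columns : ∀ {f g} → Additive f → Additive g → (∀ x → f x ≡ g x → x ≡ 0V) →
                T (apart (columns f) (columns g))
apart-columns {f} {g} f-add g-add distinct =
  subst (T ∘ det₂) (sym (toV9-⊕ (f e₁) (f e₂) (f e₃) (g e₁) (g e₂) (g e₃)))
    (det₂-columns (⊕-additive f-add g-add) (λ x eq → distinct x (⊕-zero⇒≡ eq)))

-- Partial spread sets and commuting matrices

module SpreadSet (F : Fin 6 → Iso 3) (F-zero : ∀ y → to (F zero) y ≡ y)
             (distinct : ∀ {k l} → k ≢ l → ∀ y → to (F k) y ≡ to (F l) y → y ≡ 0V) where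

  mat : Fin 6 → V9
  mat k = columns (to (F k))

  mat-apart : ∀ {k l} → k ≢ l → T (apart (mat k) (mat l))
  mat-apart {k} {l} k≢l = apart-columns (to-additive (F k)) (to-additive (F l)) (distinct k≢l)

  mat-fixedPointFree : ∀ k → T (fixedPointFree (mat (suc k)))
  mat-fixedPointFree k = T-∧⁺
    (det₂-columns (to-additive (F (suc k))) (λ _ → kernel-zero (F (suc k))))
    (subst (λ M → T (apart (mat (suc k)) M)) (columns-cong F-zero) (mat-apart (λ ())))

  mat-∈ : ∀ k → mat (suc k) ∈ fixedPointFrees
  mat-∈ k = ∈-fixedPointFrees (mat (suc k)) (mat-fixedPointFree k)

  -- Index zero is the identity, which leaves five candidates; `other k` picks one of the three not
  -- involved as the third member that the check on triples calls for.
  mat-commutes : ∀ k → T (commutes (mat (suc zero)) (mat (suc (suc k))))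
  mat-commutes k = Triples.sound {Ps = fixedPointFrees} {R = mat (suc (suc (other k)))} Triples.checked
    (mat-∈ zero) (mat-∈ (suc k)) (mat-∈ (suc (other k)))
    (mat-apart (λ ())) (mat-apart (λ ())) (mat-apart (λ eq → other-≢ k (suc-injective (suc-injective eq))))
    where
    other : Fin 4 → Fin 4
    other zero    = suc zero
    other (suc _) = zero
    other-≢ : ∀ k → k ≢ other k
    other-≢ zero    ()
    other-≢ (suc _) ()

module Commutation {P Q : Fin 6 → Iso 3}
                   (P-zero : ∀ y → to (P zero) y ≡ y) (Q-zero : ∀ y → to (Q zero) y ≡ y)
                   (ind : Independent (graphs P Q)) where

  open GraphConditions ind

  R : Fin 6 → Iso 3
  R k = Q k ∘ᴵ inverse (P k)

  R-zero : ∀ y → to (R zero) y ≡ y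
  R-zero y = trans (Q-zero _) (trans (sym (P-zero _)) (to∘from (P zero) y))

  module P′ = SpreadSet P P-zero P-distinct
  module Q′ = SpreadSet Q Q-zero Q-distinct
  module R′ = SpreadSet R R-zero R-distinct

  R·P : ∀ k → R′.mat k · P′.mat k ≡ Q′.mat k
  R·P k = trans (columns-· (to-additive (R k)) (to-additive (P k)))
                (columns-cong (λ x → cong (to (Q k)) (from∘to (P k) x)))

  -- The two graphs compared are a fixed one, `l`, and a further one, `l′`; as `k` varies, the first
  -- `P` is seen to commute with every `Q`.
  P-Q-commutes : ∀ k → T (commutes (P′.mat (suc zero)) (Q′.mat (suc zero))) ×
                       T (commutes (P′.mat (suc zero)) (Q′.mat (suc (suc k))))
  P-Q-commutes k =
    subst₂ (λ M N → T (commutes (P′.mat l) M) × T (commutes (P′.mat l) N)) (R·P l) (R·P l′)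
      (Pairs.sound {fixedPointFrees} {P′.mat l} {R′.mat l} {P′.mat l′} {R′.mat l′} Pairs.checked
        (P′.mat-∈ zero) (R′.mat-∈ zero) (P′.mat-∈ (suc k)) (R′.mat-∈ (suc k))
        (subst (T ∘ fixedPointFree) (sym (R·P l)) (Q′.mat-fixedPointFree zero))
        (subst (T ∘ fixedPointFree) (sym (R·P l′)) (Q′.mat-fixedPointFree (suc k)))
        (P′.mat-apart (λ ())) (R′.mat-apart (λ ()))
        (subst₂ (λ M N → T (apart M N)) (sym (R·P l)) (sym (R·P l′)) (Q′.mat-apart (λ ())))
        (P′.mat-commutes k) (R′.mat-commutes k)
        (subst₂ (λ M N → T (commutes M N)) (sym (R·P l)) (sym (R·P l′)) (Q′.mat-commutes k)))
    where
    l l′ : Fin 6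
    l  = suc zero
    l′ = suc (suc k)

  private
    p : V 3 → V 3
    p = to (P (suc zero))

    commute : ∀ (f : Iso 3) → T (commutes (columns p) (columns (to f))) → Commute p (to f)
    commute f = commutes-sound (to-additive (P (suc zero))) (to-additive f)

  P₁-fixedPointFree : T (fixedPointFree (columns p))
  P₁-fixedPointFree = P′.mat-fixedPointFree zero

  P-P-commute : ∀ k → Commute p (to (P k))
  P-P-commute zero          x = trans (cong p (P-zero x)) (sym (P-zero (p x)))
  P-P-commute (suc zero)    x = refl
  P-P-commute (suc (suc k))   = commute (P (suc (suc k))) (P′.mat-commutes k)

  P-Q-commute : ∀ k → Commute p (to (Q k))
  P-Q-commute zero          x = trans (cong p (Q-zero x)) (sym (Q-zero (p x)))
  P-Q-commute (suc zero)      = commute (Q (suc zero)) (proj₁ (P-Q-commutes zero))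
  P-Q-commute (suc (suc k))   = commute (Q (suc (suc k))) (proj₂ (P-Q-commutes k))

-- Coordinates over GF(8)

-- The basis e₁, Ce₁, C²e₁. If C³ = C + 1, sending 1, x, x² to it turns multiplication by x in GF(8)
-- into C.
krylov : V9 → V9
krylov C = toV9 (e₁ , act C e₁ , act C (act C e₁))

isMulX : V9 → Bool
isMulX C = isInjective (krylov C) ∧
  all (λ y → act (krylov C) (mulX y) == act C (act (krylov C) y)) (vectors 3)

-- A fixed-point-free P has characteristic polynomial x³ + x + 1 or x³ + x² + 1; in the second
-- case P + 1 has the first.
fixedPointFree⇒mulX : ∀ P → T (fixedPointFree P) → T (isMulX P) ⊎ T (isMulX (P ⊕ I₃))
fixedPointFree⇒mulX P f = T-∨⁻ (T-⇒ (all-elim test checked (∈-vectors P)) f)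
  where
  test : V9 → Bool
  test P = fixedPointFree P ⇒ isMulX P ∨ isMulX (P ⊕ I₃)
  checked : all test (vectors 9) ≡ true
  checked = refl

-- Arithmetic of GF(8)

forall₂ : (p : V 3 → V 3 → Bool) → all (λ a → all (p a) (vectors 3)) (vectors 3) ≡ true →
  ∀ a b → T (p a b)
forall₂ p ok a b = all-elim (p a)
  (T⇒true (all-elim (λ a → all (p a) (vectors 3)) ok (∈-vectors a))) (∈-vectors b)

forall₃ : (p : V 3 → V 3 → V 3 → Bool) →
  all (λ a → all (λ b → all (p a b) (vectors 3)) (vectors 3)) (vectors 3) ≡ true → ∀ a b c → T (p a b c)
forall₃ p ok a = forall₂ (p a) (T⇒true
  (all-elim (λ a → all (λ b → all (p a b) (vectors 3)) (vectors 3)) ok (∈-vectors a)))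

*8-combination : ∀ a b → a *8 b ≡ combination b (mulX b) (mulX (mulX b)) a
*8-combination (_ ∷ _ ∷ _ ∷ []) b = refl

*8-additiveˡ : ∀ b → Additive (_*8 b)
*8-additiveˡ b x y = trans (*8-combination (x ⊕ y) b)
  (trans (combination-additive b (mulX b) (mulX (mulX b)) x y)
         (sym (cong₂ _⊕_ (*8-combination x b) (*8-combination y b))))

*8-comm : ∀ a b → a *8 b ≡ b *8 a
*8-comm a b = ==-sound (forall₂ (λ a b → a *8 b == b *8 a) refl a b)

*8-assoc : ∀ a b c → (a *8 b) *8 c ≡ a *8 (b *8 c)
*8-assoc a b c = ==-sound (forall₃ (λ a b c → (a *8 b) *8 c == a *8 (b *8 c)) refl a b c)

*8-additiveʳ : ∀ a → Additive (a *8_)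
*8-additiveʳ a x y = trans (*8-comm a (x ⊕ y))
  (trans (*8-additiveˡ a x y) (cong₂ _⊕_ (*8-comm x a) (*8-comm y a)))

*8-zeroʳ : ∀ a → a *8 0V ≡ 0V
*8-zeroʳ a = additive-zero (*8-additiveʳ a)

*8-identityˡ : ∀ a → one8 *8 a ≡ a
*8-identityˡ a = ==-sound (all-elim (λ a → one8 *8 a == a) refl (∈-vectors a))

*8-identityʳ : ∀ a → a *8 one8 ≡ a
*8-identityʳ a = trans (*8-comm a one8) (*8-identityˡ a)

*8-cancel : ∀ a b → a *8 b ≡ 0V → a ≢ 0V → b ≡ 0V
*8-cancel a b ab≡0 a≢0 with T-∨⁻ {isZero a} (T-⇒ {isZero (a *8 b)}
  (forall₂ (λ a b → isZero (a *8 b) ⇒ isZero a ∨ isZero b) refl a b) (isZero-complete ab≡0))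
... | inj₁ a≡0 = ⊥-elim (a≢0 (isZero-sound a≡0))
... | inj₂ b≡0 = isZero-sound b≡0

point : Point28 → V 3 → V9
point X a = toV9 (scaleP a X)

point-additive : ∀ X → Additive (point X)
point-additive (x , y , z) a b = trans
  (toV9-cong (*8-additiveˡ x a b) (*8-additiveˡ y a b) (*8-additiveˡ z a b))
  (sym (toV9-⊕ (a *8 x) (a *8 y) (a *8 z) (b *8 x) (b *8 y) (b *8 z)))

span-pointSubspace : ∀ X a → span (pointSubspace X) a ≡ point X a
span-pointSubspace X a = sym (additive-basis (point-additive X) a)

-- Since x generates GF(8), a map that commutes with multiplication by x is GF(8)-linear, and so it
-- is multiplication by its value at 1.
mulX-linear : ∀ {f} → Additive f → Commute f mulX → ∀ a → f a ≡ a *8 f one8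
mulX-linear {f} f-add f-mulX a = trans (additive-basis f-add a)
  (trans (combination-cong refl (f-mulX one8) (trans (f-mulX x8) (cong mulX (f-mulX one8))) a)
         (sym (*8-combination a (f one8))))

-- From commuting graphs to points of PG(2,8)

framed : (α β : Fin 6 → GF8) → Fin 9 → Point28
framed α β zero                = (one8 , zero8 , zero8)
framed α β (suc zero)          = (zero8 , one8 , zero8)
framed α β (suc (suc zero))    = (zero8 , zero8 , one8)
framed α β (suc (suc (suc k))) = (one8 , α k , β k)

OverGF8 : (P Q : Fin 6 → Iso 3) → Set
OverGF8 P Q = ∃[ α ] ∃[ β ] (α zero ≡ one8 × β zero ≡ one8 × graphs P Q ≅ (λ i → point (framed α β i)))

module FieldCoordinates {P Q : Fin 6 → Iso 3}
                        (P-zero : ∀ y → to (P zero) y ≡ y) (Q-zero : ∀ y → to (Q zero) y ≡ y)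
                        {c : V 3 → V 3} (c-add : Additive c) (c-mulX : T (isMulX (columns c)))
                        (c-P : ∀ k → Commute c (to (P k))) (c-Q : ∀ k → Commute c (to (Q k))) where

  private
    K : V9
    K = krylov (columns c)

    κ : Iso 3
    κ = iso-from-kernel (act K) (act-additive K) λ x eq → isZero-sound
      (T-⇒ (all-elim (λ x → isZero (act K x) ⇒ isZero x)
        (T⇒true (proj₁ (T-∧⁻ {isInjective K} c-mulX))) (∈-vectors x)) (isZero-complete eq))

    κ-mulX : ∀ y → to κ (mulX y) ≡ c (to κ y)
    κ-mulX y = trans (==-sound (all-elim (λ y → act K (mulX y) == act (columns c) (act K y))
      (T⇒true (proj₂ (T-∧⁻ {isInjective K} c-mulX))) (∈-vectors y))) (act-columns c-add (to κ y))

    conjugate : Iso 3 → Iso 3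
    conjugate f = inverse κ ∘ᴵ (f ∘ᴵ κ)

    conjugate-mulX : ∀ f → Commute c (to f) → Commute (to (conjugate f)) mulX
    conjugate-mulX f c-f y = to-injective κ (begin
      to κ (from κ (to f (to κ (mulX y))))   ≡⟨ to∘from κ _ ⟩
      to f (to κ (mulX y))                   ≡⟨ cong (to f) (κ-mulX y) ⟩
      to f (c (to κ y))                      ≡⟨ sym (c-f (to κ y)) ⟩
      c (to f (to κ y))                      ≡⟨ cong c (sym (to∘from κ _)) ⟩
      c (to κ (from κ (to f (to κ y))))      ≡⟨ sym (κ-mulX (from κ (to f (to κ y)))) ⟩
      to κ (mulX (from κ (to f (to κ y))))   ∎)
      where open ≡-Reasoning

    scalar : Iso 3 → GF8
    scalar f = to (conjugate f) one8

    conjugate-scalar : ∀ f → Commute c (to f) → ∀ y → from κ (to f y) ≡ from κ y *8 scalar f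
    conjugate-scalar f c-f y = trans (cong (from κ ∘ to f) (sym (to∘from κ y)))
      (mulX-linear (to-additive (conjugate f)) (conjugate-mulX f c-f) (from κ y))

    scalar-id : ∀ f → (∀ y → to f y ≡ y) → scalar f ≡ one8
    scalar-id f f≗id = trans (cong (from κ) (f≗id _)) (from∘to κ one8)

    -- One and the same identification with GF(8) is used in all three blocks; the graphs become
    -- scalar because `c` commutes with the `P`'s and the `Q`'s alike.
    θ : Iso 9
    θ = blockᴵ (inverse κ) (inverse κ) (inverse κ)

    θ-toV9 : ∀ a b c → to θ (toV9 (a , b , c)) ≡ toV9 (from κ a , from κ b , from κ c)
    θ-toV9 = blockMap-toV9 (from κ) (from κ) (from κ)

    κ⁻¹-0V : ∀ y → from κ 0V ≡ from κ y *8 zero8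
    κ⁻¹-0V y = trans (to-zero (inverse κ)) (sym (*8-zeroʳ (from κ y)))

    κ⁻¹-one : ∀ y → from κ y ≡ from κ y *8 one8
    κ⁻¹-one y = sym (*8-identityʳ (from κ y))

  α β : Fin 6 → GF8
  α k = scalar (P k)
  β k = scalar (Q k)

  α-zero : α zero ≡ one8
  α-zero = scalar-id (P zero) P-zero

  β-zero : β zero ≡ one8
  β-zero = scalar-id (Q zero) Q-zero

  field-form : graphs P Q ≅ (λ i → point (framed α β i))
  field-form = θ , λ i → inverse κ , form i
    where
    form : ∀ i y → to θ (graphs P Q i y) ≡ point (framed α β i) (from κ y)
    form zero y = trans (θ-toV9 y 0V 0V) (toV9-cong (κ⁻¹-one y) (κ⁻¹-0V y) (κ⁻¹-0V y))
    form (suc zero) y = trans (θ-toV9 0V y 0V) (toV9-cong (κ⁻¹-0V y) (κ⁻¹-one y) (κ⁻¹-0V y))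
    form (suc (suc zero)) y = trans (θ-toV9 0V 0V y) (toV9-cong (κ⁻¹-0V y) (κ⁻¹-0V y) (κ⁻¹-one y))
    form (suc (suc (suc k))) y = trans (θ-toV9 y (to (P k) y) (to (Q k) y))
      (toV9-cong (κ⁻¹-one y) (conjugate-scalar (P k) (c-P k) y) (conjugate-scalar (Q k) (c-Q k) y))

  coordinates : OverGF8 P Q
  coordinates = α , β , α-zero , β-zero , field-form

graphs-over-GF8 : ∀ {P Q : Fin 6 → Iso 3} → (∀ y → to (P zero) y ≡ y) → (∀ y → to (Q zero) y ≡ y) →
                  Independent (graphs P Q) → OverGF8 P Q
graphs-over-GF8 {P} {Q} P-zero Q-zero ind =
  [ (λ mulX-p → FieldCoordinates.coordinates P-zero Q-zero (to-additive p) mulX-p p-P p-Q)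
  , (λ mulX-p+1 → FieldCoordinates.coordinates P-zero Q-zero p+1-additive
      (subst (T ∘ isMulX) p+1-columns mulX-p+1)
      (λ k → p+1-commute (P k) (p-P k)) (λ k → p+1-commute (Q k) (p-Q k)))
  ]′ (fixedPointFree⇒mulX (columns (to p)) (Commutation.P₁-fixedPointFree P-zero Q-zero ind))
  where
  p : Iso 3
  p = P (suc zero)

  p-P : ∀ k → Commute (to p) (to (P k))
  p-P = Commutation.P-P-commute P-zero Q-zero ind

  p-Q : ∀ k → Commute (to p) (to (Q k))
  p-Q = Commutation.P-Q-commute P-zero Q-zero ind

  p+1 : V 3 → V 3
  p+1 x = to p x ⊕ x

  p+1-additive : Additive p+1
  p+1-additive = ⊕-additive {f = to p} {λ x → x} (to-additive p) (λ _ _ → refl)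

  p+1-columns : columns (to p) ⊕ I₃ ≡ columns p+1
  p+1-columns = toV9-⊕ (to p e₁) (to p e₂) (to p e₃) e₁ e₂ e₃

  p+1-commute : ∀ (f : Iso 3) → Commute (to p) (to f) → Commute p+1 (to f)
  p+1-commute f p-f x = trans (cong (_⊕ to f x) (p-f x)) (sym (to-additive f (to p x) x))

-- Polynomial identities and determinants over GF(8)

GF8-semiring : CommutativeSemiring 0ℓ 0ℓ
GF8-semiring = record
  { Carrier = GF8
  ; _≈_ = _≡_
  ; _+_ = _⊕_
  ; _*_ = _*8_
  ; 0# = zero8
  ; 1# = one8
  ; isCommutativeSemiring = isCommutativeSemiringˡ record
    { +-isCommutativeMonoid = record
      { isMonoid = record
        { isSemigroup = record
          { isMagma = record { isEquivalence = isEquivalence ; ∙-cong = cong₂ _⊕_ }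
          ; assoc = ⊕-assoc }
        ; identity = ⊕-identityˡ , ⊕-identityʳ }
      ; comm = ⊕-comm }
    ; *-isCommutativeMonoid = record
      { isMonoid = record
        { isSemigroup = record
          { isMagma = record { isEquivalence = isEquivalence ; ∙-cong = cong₂ _*8_ }
          ; assoc = *8-assoc }
        ; identity = *8-identityˡ , *8-identityʳ }
      ; comm = *8-comm }
    ; distribʳ = λ x y z → *8-additiveˡ x y z
    ; zeroˡ = λ x → additive-zero (*8-additiveˡ x)
    }
  }

-- The coefficients are elements of GF(8) themselves, so 1 + 1 evaluates to 0 and identities
-- peculiar to characteristic two can be solved.
module GF8-Solver = RingSolver (fromCommutativeSemiring GF8-semiring) (≡-dec Bool._≟_)

det₈ : Point28 → Point28 → Point28 → GF8
det₈ (x₁ , x₂ , x₃) (y₁ , y₂ , y₃) (z₁ , z₂ , z₃) =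
  (x₁ *8 ((y₂ *8 z₃) ⊕ (y₃ *8 z₂))) ⊕ ((x₂ *8 ((y₁ *8 z₃) ⊕ (y₃ *8 z₁))) ⊕ (x₃ *8 ((y₁ *8 z₂) ⊕ (y₂ *8 z₁))))

-- The cofactors of the first vector are applied to the three coordinates of the combination; the
-- terms in `b` and `c` are determinants with a repeated row and vanish. The other two unknowns are
-- reached by permuting the vectors, which changes no sign in characteristic two.
cramer : ∀ a b c x₁ x₂ x₃ y₁ y₂ y₃ z₁ z₂ z₃ →
  a *8 det₈ (x₁ , x₂ , x₃) (y₁ , y₂ , y₃) (z₁ , z₂ , z₃) ≡
  (((y₂ *8 z₃) ⊕ (y₃ *8 z₂)) *8 ((a *8 x₁) ⊕ ((b *8 y₁) ⊕ (c *8 z₁)))) ⊕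
  ((((y₁ *8 z₃) ⊕ (y₃ *8 z₁)) *8 ((a *8 x₂) ⊕ ((b *8 y₂) ⊕ (c *8 z₂)))) ⊕
   (((y₁ *8 z₂) ⊕ (y₂ *8 z₁)) *8 ((a *8 x₃) ⊕ ((b *8 y₃) ⊕ (c *8 z₃)))))
cramer = solve 12 (λ a b c x₁ x₂ x₃ y₁ y₂ y₃ z₁ z₂ z₃ →
  a :* ((x₁ :* ((y₂ :* z₃) :+ (y₃ :* z₂))) :+
        ((x₂ :* ((y₁ :* z₃) :+ (y₃ :* z₁))) :+ (x₃ :* ((y₁ :* z₂) :+ (y₂ :* z₁)))))
  := (((y₂ :* z₃) :+ (y₃ :* z₂)) :* ((a :* x₁) :+ ((b :* y₁) :+ (c :* z₁)))) :+
  ((((y₁ :* z₃) :+ (y₃ :* z₁)) :* ((a :* x₂) :+ ((b :* y₂) :+ (c :* z₂)))) :+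
   (((y₁ :* z₂) :+ (y₂ :* z₁)) :* ((a :* x₃) :+ ((b :* y₃) :+ (c :* z₃)))))) refl
  where open GF8-Solver

det₈-swap₁₂ : ∀ X Y Z → det₈ Y X Z ≡ det₈ X Y Z
det₈-swap₁₂ (x₁ , x₂ , x₃) (y₁ , y₂ , y₃) (z₁ , z₂ , z₃) = solve 9 (λ x₁ x₂ x₃ y₁ y₂ y₃ z₁ z₂ z₃ →
  det y₁ y₂ y₃ x₁ x₂ x₃ z₁ z₂ z₃ := det x₁ x₂ x₃ y₁ y₂ y₃ z₁ z₂ z₃) refl x₁ x₂ x₃ y₁ y₂ y₃ z₁ z₂ z₃
  where
  open GF8-Solver
  det : ∀ {n} → (x₁ x₂ x₃ y₁ y₂ y₃ z₁ z₂ z₃ : Polynomial n) → Polynomial n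
  det x₁ x₂ x₃ y₁ y₂ y₃ z₁ z₂ z₃ =
    (x₁ :* ((y₂ :* z₃) :+ (y₃ :* z₂))) :+
    ((x₂ :* ((y₁ :* z₃) :+ (y₃ :* z₁))) :+ (x₃ :* ((y₁ :* z₂) :+ (y₂ :* z₁))))

det₈-swap₂₃ : ∀ X Y Z → det₈ X Z Y ≡ det₈ X Y Z
det₈-swap₂₃ (x₁ , x₂ , x₃) (y₁ , y₂ , y₃) (z₁ , z₂ , z₃) =
  cong₂ _⊕_ (cong (x₁ *8_) (minor z₂ z₃ y₂ y₃))
    (cong₂ _⊕_ (cong (x₂ *8_) (minor z₁ z₃ y₁ y₃)) (cong (x₃ *8_) (minor z₁ z₂ y₁ y₂)))
  where
  minor : ∀ a b c d → (a *8 d) ⊕ (b *8 c) ≡ (c *8 b) ⊕ (d *8 a)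
  minor a b c d = trans (⊕-comm (a *8 d) (b *8 c)) (cong₂ _⊕_ (*8-comm b c) (*8-comm a d))

-- Projectivities of PG(2,8), given by the images of the three coordinate points

infixl 6 _⊞_

_⊞_ : Point28 → Point28 → Point28
(a , b , c) ⊞ (a′ , b′ , c′) = (a ⊕ a′ , b ⊕ b′ , c ⊕ c′)

0P : Point28
0P = (0V , 0V , 0V)

Frame : Set
Frame = Point28 × Point28 × Point28

lin : Frame → Point28 → Point28
lin (X , Y , Z) (a , b , c) = scaleP a X ⊞ (scaleP b Y ⊞ scaleP c Z)

det : Frame → GF8
det (X , Y , Z) = det₈ X Y Z

toV9-⊞ : ∀ X Y → toV9 (X ⊞ Y) ≡ toV9 X ⊕ toV9 Y
toV9-⊞ (a , b , c) (a′ , b′ , c′) = sym (toV9-⊕ a b c a′ b′ c′)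

point-sum : ∀ X Y Z a b c → point X a ⊕ (point Y b ⊕ point Z c) ≡ toV9 (lin (X , Y , Z) (a , b , c))
point-sum X Y Z a b c = sym (trans (toV9-⊞ (scaleP a X) _)
  (cong (point X a ⊕_) (toV9-⊞ (scaleP b Y) (scaleP c Z))))

components : ∀ {a b c a′ b′ c′ : GF8} → (a , b , c) ≡ (a′ , b′ , c′) → a ≡ a′ × b ≡ b′ × c ≡ c′
components refl = refl , refl , refl

lin-kernel₁ : ∀ X Y Z a b c → det₈ X Y Z ≢ 0V → lin (X , Y , Z) (a , b , c) ≡ 0P → a ≡ 0V
lin-kernel₁ (x₁ , x₂ , x₃) (y₁ , y₂ , y₃) (z₁ , z₂ , z₃) a b c det≢0 eq
  with eq₁ , eq₂ , eq₃ ← components eq = *8-cancel _ a (begin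
  det₈ (x₁ , x₂ , x₃) (y₁ , y₂ , y₃) (z₁ , z₂ , z₃) *8 a
    ≡⟨ trans (*8-comm _ a) (cramer a b c x₁ x₂ x₃ y₁ y₂ y₃ z₁ z₂ z₃) ⟩
  (((y₂ *8 z₃) ⊕ (y₃ *8 z₂)) *8 ((a *8 x₁) ⊕ ((b *8 y₁) ⊕ (c *8 z₁)))) ⊕
  ((((y₁ *8 z₃) ⊕ (y₃ *8 z₁)) *8 ((a *8 x₂) ⊕ ((b *8 y₂) ⊕ (c *8 z₂)))) ⊕
   (((y₁ *8 z₂) ⊕ (y₂ *8 z₁)) *8 ((a *8 x₃) ⊕ ((b *8 y₃) ⊕ (c *8 z₃)))))
    ≡⟨ cong₂ _⊕_ (vanish ((y₂ *8 z₃) ⊕ (y₃ *8 z₂)) eq₁)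
         (cong₂ _⊕_ (vanish ((y₁ *8 z₃) ⊕ (y₃ *8 z₁)) eq₂) (vanish ((y₁ *8 z₂) ⊕ (y₂ *8 z₁)) eq₃)) ⟩
  0V ∎) det≢0
  where
  open ≡-Reasoning
  vanish : ∀ m {s} → s ≡ 0V → m *8 s ≡ 0V
  vanish m refl = *8-zeroʳ m

lin-swap₁₂ : ∀ X Y Z a b c → lin (Y , X , Z) (b , a , c) ≡ lin (X , Y , Z) (a , b , c)
lin-swap₁₂ (x₁ , x₂ , x₃) (y₁ , y₂ , y₃) (z₁ , z₂ , z₃) a b c =
  cong₂ _,_ (swap (b *8 y₁) (a *8 x₁) (c *8 z₁))
    (cong₂ _,_ (swap (b *8 y₂) (a *8 x₂) (c *8 z₂)) (swap (b *8 y₃) (a *8 x₃) (c *8 z₃)))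
  where
  swap : ∀ (u v w : GF8) → u ⊕ (v ⊕ w) ≡ v ⊕ (u ⊕ w)
  swap u v w = trans (sym (⊕-assoc u v w)) (trans (cong (_⊕ w) (⊕-comm u v)) (⊕-assoc v u w))

lin-swap₂₃ : ∀ X Y Z a b c → lin (X , Z , Y) (a , c , b) ≡ lin (X , Y , Z) (a , b , c)
lin-swap₂₃ (x₁ , x₂ , x₃) (y₁ , y₂ , y₃) (z₁ , z₂ , z₃) a b c =
  cong₂ _,_ (cong ((a *8 x₁) ⊕_) (⊕-comm (c *8 z₁) (b *8 y₁)))
    (cong₂ _,_ (cong ((a *8 x₂) ⊕_) (⊕-comm (c *8 z₂) (b *8 y₂)))
      (cong ((a *8 x₃) ⊕_) (⊕-comm (c *8 z₃) (b *8 y₃))))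

lin-kernel : ∀ X Y Z a b c → det₈ X Y Z ≢ 0V → lin (X , Y , Z) (a , b , c) ≡ 0P → a ≡ 0V × b ≡ 0V × c ≡ 0V
lin-kernel X Y Z a b c det≢0 eq =
    lin-kernel₁ X Y Z a b c det≢0 eq
  , lin-kernel₁ Y X Z b a c (det≢0 ∘ trans (sym (det₈-swap₁₂ X Y Z))) (trans (lin-swap₁₂ X Y Z a b c) eq)
  , lin-kernel₁ Z X Y c a b (det≢0 ∘ trans (sym (trans (det₈-swap₁₂ X Z Y) (det₈-swap₂₃ X Y Z))))
      (trans (lin-swap₁₂ X Z Y a c b) (trans (lin-swap₂₃ X Y Z a b c) eq))

toV9-injectiveP : ∀ {X Y} → toV9 X ≡ toV9 Y → X ≡ Y
toV9-injectiveP {a , b , c} {a′ , b′ , c′} eq =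
  let e₁ , e₂ , e₃ = toV9-injective {a} {b} {c} {a′} {b′} {c′} eq in cong₂ _,_ e₁ (cong₂ _,_ e₂ e₃)

points-independent : ∀ X Y Z → det₈ X Y Z ≢ 0V →
  ∀ a b c → point X a ⊕ (point Y b ⊕ point Z c) ≡ 0V → a ≡ 0V × b ≡ 0V × c ≡ 0V
points-independent X Y Z det≢0 a b c eq =
  lin-kernel X Y Z a b c det≢0
    (toV9-injectiveP {lin (X , Y , Z) (a , b , c)} {0P} (trans (sym (point-sum X Y Z a b c)) eq))

lift : Frame → V9 → V9
lift (X , Y , Z) v = point X (π₁ v) ⊕ (point Y (π₂ v) ⊕ point Z (π₃ v))

lift-point : ∀ M W a → lift M (point W a) ≡ point (lin M W) a
lift-point M@(X@(x₁ , x₂ , x₃) , Y@(y₁ , y₂ , y₃) , Z@(z₁ , z₂ , z₃)) (u , v , w) a = begin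
  lift M (toV9 (a *8 u , a *8 v , a *8 w))
    ≡⟨ cong₂ _⊕_ (cong (point X) (π₁-toV9 (a *8 u) (a *8 v) (a *8 w)))
         (cong₂ _⊕_ (cong (point Y) (π₂-toV9 (a *8 u) (a *8 v) (a *8 w)))
                    (cong (point Z) (π₃-toV9 (a *8 u) (a *8 v) (a *8 w)))) ⟩
  point X (a *8 u) ⊕ (point Y (a *8 v) ⊕ point Z (a *8 w))
    ≡⟨ point-sum X Y Z (a *8 u) (a *8 v) (a *8 w) ⟩
  toV9 (lin M (a *8 u , a *8 v , a *8 w))
    ≡⟨ toV9-cong (factor x₁ y₁ z₁) (factor x₂ y₂ z₂) (factor x₃ y₃ z₃) ⟩
  point (lin M (u , v , w)) a ∎
  where
  open ≡-Reasoning
  factor : ∀ x y z → ((a *8 u) *8 x) ⊕ (((a *8 v) *8 y) ⊕ ((a *8 w) *8 z)) ≡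
                     a *8 ((u *8 x) ⊕ ((v *8 y) ⊕ (w *8 z)))
  factor x y z = sym (trans (*8-additiveʳ a (u *8 x) _) (cong₂ _⊕_ (sym (*8-assoc a u x))
    (trans (*8-additiveʳ a (v *8 y) _) (cong₂ _⊕_ (sym (*8-assoc a v y)) (sym (*8-assoc a w z))))))

point-scaleP : ∀ l X a → point (scaleP l X) a ≡ point X (a *8 l)
point-scaleP l (x , y , z) a = toV9-cong (sym (*8-assoc a l x)) (sym (*8-assoc a l y)) (sym (*8-assoc a l z))

lift-additive : ∀ M → Additive (lift M)
lift-additive (X , Y , Z) = ⊕-additive {f = f} {λ v → g v ⊕ h v} f-add (⊕-additive {f = g} {h} g-add h-add)
  where
  f g h : V9 → V9
  f v = point X (π₁ v)
  g v = point Y (π₂ v)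
  h v = point Z (π₃ v)
  f-add : Additive f
  f-add = ∘-additive {g = point X} {π₁} (point-additive X) π₁-additive
  g-add : Additive g
  g-add = ∘-additive {g = point Y} {π₂} (point-additive Y) π₂-additive
  h-add : Additive h
  h-add = ∘-additive {g = point Z} {π₃} (point-additive Z) π₃-additive

liftᴵ : (M : Frame) → det M ≢ 0V → Iso 9
liftᴵ M@(X , Y , Z) det≢0 = iso-from-kernel (lift M) (lift-additive M) ker
  where
  ker : ∀ v → lift M v ≡ 0V → v ≡ 0V
  ker v eq = let a≡0 , b≡0 , c≡0 = points-independent X Y Z det≢0 (π₁ v) (π₂ v) (π₃ v) eq in
    trans (sym (toV9-π v)) (toV9-cong a≡0 b≡0 c≡0)

scaleᴵ : (l : GF8) → l ≢ 0V → Iso 3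
scaleᴵ l l≢0 = iso-from-kernel (_*8 l) (*8-additiveˡ l) (λ a eq → *8-cancel l a (trans (*8-comm l a) eq) l≢0)

isZeroP : Point28 → Bool
isZeroP (a , b , c) = isZero a ∧ isZero b ∧ isZero c

_==P_ : Point28 → Point28 → Bool
(a , b , c) ==P (a′ , b′ , c′) = (a == a′) ∧ (b == b′) ∧ (c == c′)

==P-sound : ∀ {X Y} → T (X ==P Y) → X ≡ Y
==P-sound {a , b , c} {a′ , b′ , c′} t =
  let t₁ , t₂₃ = T-∧⁻ {a == a′} t ; t₂ , t₃ = T-∧⁻ {b == b′} t₂₃ in
  cong₂ _,_ (==-sound t₁) (cong₂ _,_ (==-sound t₂) (==-sound t₃))

-- Ovals of PG(2,8) containing the standard frame

AffinePoint : Set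
AffinePoint = GF8 × GF8

unit : AffinePoint
unit = (one8 , one8)

-- The three conditions say that the line joining (1, α, β) and (1, α′, β′) misses (0,0,1), (0,1,0)
-- and (1,0,0), in this order.
distinctSlopes : AffinePoint → AffinePoint → Bool
distinctSlopes (α , β) (α′ , β′) = not (α == α′) ∧ not (β == β′) ∧ not (α *8 β′ == α′ *8 β)

noncollinear : AffinePoint → AffinePoint → AffinePoint → Bool
noncollinear (α , β) (α′ , β′) (α″ , β″) =
  not ((α′ ⊕ α) *8 (β″ ⊕ β) == (α″ ⊕ α) *8 (β′ ⊕ β))

candidate : AffinePoint → Bool
candidate p@(α , β) = not (isZero α) ∧ not (isZero β) ∧ distinctSlopes unit p

compatible : AffinePoint → AffinePoint → Bool
compatible p q = distinctSlopes p q ∧ noncollinear unit p q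

hyperoval : Fin 10 → Point28
hyperoval zero    = (zero8 , one8 , zero8)
hyperoval (suc i) = conic i

-- In characteristic two the tangents of y² = xz have equations in x and z alone, so they all pass
-- through (0,1,0), the nucleus. The zero vector passes the test too and has to be excluded
-- separately.
onHyperoval : Point28 → Bool
onHyperoval (x , y , z) = (y *8 y == x *8 z) ∨ (isZero x ∧ isZero z)

X₁ X₂ X₃ : Point28
X₁ = (one8 , zero8 , zero8)
X₂ = (zero8 , one8 , zero8)
X₃ = (zero8 , zero8 , one8)

-- The ten hyperovals through the frame are the conics x² = yz, y² = xz, z² = xy and
-- yz/a + zx/b + xy/c = 0 with (a , b , c) = (1 , 1 , 1) or (t + 1 , t , t (t + 1)),
-- each with its nucleus; the last family is carried to y² = xz by
-- (x , y , z) ↦ (a x + c z , c z , b y + c z).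
diagonal : GF8 → GF8 → GF8 → Frame
diagonal a b c = (a , zero8 , zero8) , (zero8 , zero8 , b) , (c , c , c)

hyperovalMaps : List Frame
hyperovalMaps = (X₁ , X₂ , X₃) ∷ (X₂ , X₁ , X₃) ∷ (X₁ , X₃ , X₂) ∷ diagonal one8 one8 one8 ∷
  -- The four maps before these belong to hyperovals whose nucleus is a point of the frame.
  -- Otherwise (1,1,1) must lie on the conic, that is, 1/a + 1/b + 1/c = 0, which has six solutions
  -- up to a common factor, one for each `t` other than 0 and 1.
  List.map (λ t → diagonal (t ⊕ one8) t (t *8 (t ⊕ one8)))
    (filterᵇ (λ t → not (isZero t) ∧ not (t == one8)) (vectors 3))

on : Frame → AffinePoint → Bool
on M p = onHyperoval (lin M (one8 , p))

module Arcs where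
  extensions : AffinePoint → AffinePoint → List AffinePoint → List AffinePoint
  extensions p q Ns = filterᵇ (λ r → compatible q r ∧ noncollinear p q r) Ns

  covers : AffinePoint → AffinePoint → List AffinePoint → Frame → Bool
  covers p q rs M = on M p ∧ on M q ∧ all (on M) rs

  covered : List Frame → AffinePoint → AffinePoint → List AffinePoint → Bool
  covered Ms p q rs = null rs ∨ any (covers p q rs) Ms

  row : List Frame → AffinePoint → List AffinePoint → Bool
  row Ms p Ns = all (λ q → covered Ms p q (extensions p q Ns)) Ns

  check : List Frame → List AffinePoint → Bool
  check Ms ps = all (λ p → row Ms p (filterᵇ (compatible p) ps)) ps

  Extends : AffinePoint → AffinePoint → AffinePoint → Set
  Extends p q r = T (compatible p r) × T (compatible q r) × T (noncollinear p q r)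

  -- The hyperoval is found from `p` and `q` alone and has to contain all their extensions at once,
  -- so hyperovals for different third points never need to be compared. The point `r` witnesses
  -- that the list of extensions is not empty: the alternative `null rs` lets through the six-point
  -- arcs that no point enlarges.
  sound : ∀ {Ms ps p q r} → check Ms ps ≡ true → p ∈ ps → q ∈ ps → r ∈ ps →
    T (compatible p q) → Extends p q r →
    ∃[ M ] (M ∈ Ms × T (on M p) × T (on M q) × (∀ {s} → s ∈ ps → Extends p q s → T (on M s)))
  sound {Ms} {ps} {p} {q} {r} ok p∈ q∈ r∈ pq pqr =
    let M , M∈ , cov = any-elim (covers p q Rs) {Ms} some
        on-p , rest  = T-∧⁻ {on M p} cov
        on-q , on-Rs = T-∧⁻ {on M q} rest
    in M , M∈ , on-p , on-q , λ s∈ ext → all-elim (on M) (T⇒true on-Rs) (listed s∈ ext)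
    where
    Ns Rs : List AffinePoint
    Ns = filterᵇ (compatible p) ps
    Rs = extensions p q Ns
    listed : ∀ {s} → s ∈ ps → Extends p q s → s ∈ Rs
    listed s∈ (ps , qs , pqs) = ∈-filterᵇ (λ r → compatible q r ∧ noncollinear p q r)
      (∈-filterᵇ (compatible p) s∈ ps) (T-∧⁺ qs pqs)
    T-row : T (row Ms p Ns)
    T-row = all-elim (λ p → row Ms p (filterᵇ (compatible p) ps)) ok p∈
    T-covered : T (covered Ms p q Rs)
    T-covered = all-elim (λ q → covered Ms p q (extensions p q Ns))
      (T⇒true T-row) (∈-filterᵇ (compatible p) q∈ pq)
    nonempty : ∀ {xs} {b} → r ∈ xs → T (null xs ∨ b) → T b
    nonempty {_ ∷ _} _ t = t
    some : T (any (covers p q Rs) Ms)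
    some = nonempty (listed r∈ pqr) T-covered

candidates : List AffinePoint
candidates = filterᵇ candidate (cartesianProduct (vectors 3) (vectors 3))

∈-candidates : ∀ p → T (candidate p) → p ∈ candidates
∈-candidates (α , β) = ∈-filterᵇ candidate (∈-cartesianProduct⁺ (∈-vectors α) (∈-vectors β))

arcs-checked : Arcs.check hyperovalMaps candidates ≡ true
arcs-checked = refl

containsFrame : Frame → Bool
containsFrame M = onHyperoval (lin M X₁) ∧ onHyperoval (lin M X₂) ∧ onHyperoval (lin M X₃) ∧ on M unit

maps-checked : all (λ M → not (isZero (det M)) ∧ containsFrame M) hyperovalMaps ≡ true
maps-checked = refl

units : List GF8
units = filterᵇ (not ∘ isZero) (vectors 3)

isOneOf : ∀ {n} → (Fin n → Point28) → Point28 → Bool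
isOneOf {n} Ys X = any (λ (j , l) → X ==P scaleP l (Ys j)) (cartesianProduct (allFin n) units)

zeroOrHyperoval : GF8 → GF8 → GF8 → Bool
zeroOrHyperoval x y z = onHyperoval (x , y , z) ⇒ isZeroP (x , y , z) ∨ isOneOf hyperoval (x , y , z)

hyperoval-checked :
  all (λ x → all (λ y → all (zeroOrHyperoval x y) (vectors 3)) (vectors 3)) (vectors 3) ≡ true
hyperoval-checked = refl

-- For h = (1 , s , s²) the projectivity induces t ↦ 1/(t + s) on the conic; it moves h to (0 , 0 , 1)
-- and fixes the nucleus.
moveToInfinity : Fin 9 → Frame
moveToInfinity zero    = X₁ , X₂ , X₃
moveToInfinity (suc i) = (elem8 i *8 elem8 i , elem8 i , one8) , X₂ , X₁

-- `hyperoval (suc h)` is `conic h`, the point to be left out, so only this index is exempt; its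
-- image (0,0,1) is the one point of the hyperoval that the pointed conic lacks.
move-checked : all (λ (h , j) → ⌊ suc h ≟ j ⌋ ∨ isOneOf pointedConic (lin (moveToInfinity h) (hyperoval j)))
                 (cartesianProduct (allFin 9) (allFin 10)) ≡ true
move-checked = refl

isOneOf-elim : ∀ {n} (Ys : Fin n → Point28) X → T (isOneOf Ys X) →
  ∃[ j ] ∃[ l ] (l ≢ 0V × X ≡ scaleP l (Ys j))
isOneOf-elim {n} Ys X t =
  let (j , l) , jl∈ , eq = any-elim (λ (j , l) → X ==P scaleP l (Ys j)) {cartesianProduct (allFin n) units} t
      _ , l∈             = ∈-cartesianProduct⁻ (allFin n) units jl∈
      _ , l≢0            = ∈-filter⁻ (T? ∘ (not ∘ isZero)) {xs = vectors 3} l∈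
  in j , l , (λ l≡0 → T-not l≢0 (isZero-complete l≡0)) , ==P-sound eq

onHyperoval⇒proportional : ∀ X → X ≢ 0P → T (onHyperoval X) →
  ∃[ j ] ∃[ l ] (l ≢ 0V × X ≡ scaleP l (hyperoval j))
onHyperoval⇒proportional X@(x , y , z) X≢0 onX = isOneOf-elim hyperoval X
  (nonzero (T-⇒ (forall₃ zeroOrHyperoval hyperoval-checked x y z) onX))
  where
  isZeroP-sound : T (isZeroP X) → X ≡ 0P
  isZeroP-sound t = let t₁ , t₂₃ = T-∧⁻ {isZero x} t ; t₂ , t₃ = T-∧⁻ {isZero y} t₂₃ in
    cong₂ _,_ (isZero-sound t₁) (cong₂ _,_ (isZero-sound t₂) (isZero-sound t₃))
  nonzero : ∀ {b} → T (isZeroP X ∨ b) → T b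
  nonzero t = [ (λ z → ⊥-elim (X≢0 (isZeroP-sound z))) , (λ b → b) ]′ (T-∨⁻ {isZeroP X} t)

move-proportional : ∀ h j → suc h ≢ j →
  ∃[ j′ ] ∃[ l ] (l ≢ 0V × lin (moveToInfinity h) (hyperoval j) ≡ scaleP l (pointedConic j′))
move-proportional h j sh≢j = isOneOf-elim pointedConic (lin (moveToInfinity h) (hyperoval j))
  ([ (λ eq → ⊥-elim (sh≢j (toWitness eq))) , (λ b → b) ]′ (T-∨⁻ {⌊ suc h ≟ j ⌋}
    (all-elim (λ (h , j) → ⌊ suc h ≟ j ⌋ ∨ isOneOf pointedConic (lin (moveToInfinity h) (hyperoval j)))
      move-checked (∈-cartesianProduct⁺ (∈-allFin h) (∈-allFin j)))))

move-det : ∀ h → det (moveToInfinity h) ≢ 0V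
move-det h = T-not (all-elim (λ h → not (isZero (det (moveToInfinity h)))) {allFin 9} refl (∈-allFin h))
  ∘ isZero-complete

-- Independence of framed points as an arc condition

independent-relation : ∀ {Xs : Fin 9 → Point28} → Independent (λ i → point (Xs i)) →
  ∀ {i j k} → i ≢ j → j ≢ k → i ≢ k → ∀ a b c →
  lin (Xs i , Xs j , Xs k) (a , b , c) ≡ 0P → a ≡ 0V × b ≡ 0V × c ≡ 0V
independent-relation {Xs} ind {i} {j} {k} i≢j j≢k i≢k a b c eq =
  ind i≢j j≢k i≢k a b c (trans (point-sum (Xs i) (Xs j) (Xs k) a b c) (cong toV9 eq))

triple-≡ : ∀ {a b c a′ b′ c′ : GF8} → a ≡ a′ → b ≡ b′ → c ≡ c′ → (a , b , c) ≡ (a′ , b′ , c′)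
triple-≡ refl refl refl = refl

one8≢0 : one8 ≢ 0V
one8≢0 ()

module FramedArc {α β : Fin 6 → GF8} (ind : Independent (λ i → point (framed α β i))) where

  private
    relation = independent-relation {framed α β} ind
    open GF8-Solver

    𝟘 𝟙 : ∀ {n} → Polynomial n
    𝟘 = con zero8
    𝟙 = con one8

    affine-≢ : ∀ {k l} → k ≢ l → affine k ≢ affine l
    affine-≢ k≢l refl = k≢l refl

  p : Fin 6 → AffinePoint
  p k = α k , β k

  α-nonzero : ∀ k → α k ≢ 0V
  α-nonzero k α≡0 = one8≢0 (proj₁ (relation {zero} {suc (suc zero)} {affine k} (λ ()) (λ ()) (λ ())
    one8 (β k) one8 (triple-≡
      (solve 1 (λ b → 𝟙 :* 𝟙 :+ (b :* 𝟘 :+ 𝟙 :* 𝟙) := 𝟘) refl (β k))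
      (trans (solve 2 (λ a b → 𝟙 :* 𝟘 :+ (b :* 𝟘 :+ 𝟙 :* a) := a) refl (α k) (β k)) α≡0)
      (solve 1 (λ b → 𝟙 :* 𝟘 :+ (b :* 𝟙 :+ 𝟙 :* b) := 𝟘) refl (β k)))))

  β-nonzero : ∀ k → β k ≢ 0V
  β-nonzero k β≡0 = one8≢0 (proj₁ (relation {zero} {suc zero} {affine k} (λ ()) (λ ()) (λ ())
    one8 (α k) one8 (triple-≡
      (solve 1 (λ a → 𝟙 :* 𝟙 :+ (a :* 𝟘 :+ 𝟙 :* 𝟙) := 𝟘) refl (α k))
      (solve 1 (λ a → 𝟙 :* 𝟘 :+ (a :* 𝟙 :+ 𝟙 :* a) := 𝟘) refl (α k))
      (trans (solve 2 (λ a b → 𝟙 :* 𝟘 :+ (a :* 𝟘 :+ 𝟙 :* b) := b) refl (α k) (β k)) β≡0))))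

  module _ {k l : Fin 6} (k≢l : k ≢ l) where

    α-distinct : α k ≢ α l
    α-distinct eq = one8≢0 (proj₁ (proj₂ (relation
      {suc (suc zero)} {affine k} {affine l} (λ ()) (affine-≢ k≢l) (λ ())
      (β k ⊕ β l) one8 one8 (triple-≡
        (solve 2 (λ b b′ → (b :+ b′) :* 𝟘 :+ (𝟙 :* 𝟙 :+ 𝟙 :* 𝟙) := 𝟘) refl (β k) (β l))
        (trans (solve 4 (λ a a′ b b′ → (b :+ b′) :* 𝟘 :+ (𝟙 :* a :+ 𝟙 :* a′) := a :+ a′)
                 refl (α k) (α l) (β k) (β l)) (≡⇒⊕-zero eq))
        (solve 2 (λ b b′ → (b :+ b′) :* 𝟙 :+ (𝟙 :* b :+ 𝟙 :* b′) := 𝟘) refl (β k) (β l))))))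

    β-distinct : β k ≢ β l
    β-distinct eq = one8≢0 (proj₁ (proj₂ (relation
      {suc zero} {affine k} {affine l} (λ ()) (affine-≢ k≢l) (λ ())
      (α k ⊕ α l) one8 one8 (triple-≡
        (solve 2 (λ a a′ → (a :+ a′) :* 𝟘 :+ (𝟙 :* 𝟙 :+ 𝟙 :* 𝟙) := 𝟘) refl (α k) (α l))
        (solve 2 (λ a a′ → (a :+ a′) :* 𝟙 :+ (𝟙 :* a :+ 𝟙 :* a′) := 𝟘) refl (α k) (α l))
        (trans (solve 4 (λ a a′ b b′ → (a :+ a′) :* 𝟘 :+ (𝟙 :* b :+ 𝟙 :* b′) := b :+ b′)
                 refl (α k) (α l) (β k) (β l)) (≡⇒⊕-zero eq))))))

    slope-distinct : α k *8 β l ≢ α l *8 β k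
    slope-distinct eq = β-nonzero l (proj₁ (proj₂ (relation
      {zero} {affine k} {affine l} (λ ()) (affine-≢ k≢l) (λ ())
      -- The weights `β l` and `β k` cancel the third coordinate and leave the two products of the
      -- assumed equation in the second; the coordinate point takes up the first.
      (β k ⊕ β l) (β l) (β k) (triple-≡
        (solve 2 (λ b b′ → (b :+ b′) :* 𝟙 :+ (b′ :* 𝟙 :+ b :* 𝟙) := 𝟘) refl (β k) (β l))
        (trans (solve 4 (λ a a′ b b′ → (b :+ b′) :* 𝟘 :+ (b′ :* a :+ b :* a′) := a :* b′ :+ a′ :* b)
                 refl (α k) (α l) (β k) (β l)) (≡⇒⊕-zero eq))
        (solve 2 (λ b b′ → (b :+ b′) :* 𝟘 :+ (b′ :* b :+ b :* b′) := 𝟘) refl (β k) (β l))))))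

    slopes : T (distinctSlopes (p k) (p l))
    slopes = T-∧⁺ (≢⇒T-not α-distinct) (T-∧⁺ (≢⇒T-not β-distinct) (≢⇒T-not slope-distinct))

  arc : ∀ {k l m} → k ≢ l → l ≢ m → k ≢ m → T (noncollinear (p k) (p l) (p m))
  arc {k} {l} {m} k≢l l≢m k≢m = ≢⇒T-not λ eq → α-distinct k≢m (sym (⊕-zero⇒≡ (proj₁ (proj₂
    (relation {affine k} {affine l} {affine m} (affine-≢ k≢l) (affine-≢ l≢m) (affine-≢ k≢m)
      -- These weights are the minors of the two rows of first and second coordinates. They cancel
      -- both rows identically, and the third coordinate becomes the determinant, zero by
      -- assumption; the middle weight cannot vanish because `α k` and `α m` differ.
      (α l ⊕ α m) (α m ⊕ α k) (α l ⊕ α k) (triple-≡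
        (solve 3 (λ a a′ a″ → (a′ :+ a″) :* 𝟙 :+ ((a″ :+ a) :* 𝟙 :+ (a′ :+ a) :* 𝟙) := 𝟘)
          refl (α k) (α l) (α m))
        (solve 3 (λ a a′ a″ → (a′ :+ a″) :* a :+ ((a″ :+ a) :* a′ :+ (a′ :+ a) :* a″) := 𝟘)
          refl (α k) (α l) (α m))
        (trans (solve 6 (λ a a′ a″ b b′ b″ → (a′ :+ a″) :* b :+ ((a″ :+ a) :* b′ :+ (a′ :+ a) :* b″) :=
                   (a′ :+ a) :* (b″ :+ b) :+ (a″ :+ a) :* (b′ :+ b))
                 refl (α k) (α l) (α m) (β k) (β l) (β m))
               (≡⇒⊕-zero eq))))))))

module FramedOval {α β : Fin 6 → GF8} (α-zero : α zero ≡ one8) (β-zero : β zero ≡ one8)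
                  (ind : Independent (λ i → point (framed α β i))) where

  open FramedArc {α} {β} ind

  ConicOrPointed : Set
  ConicOrPointed = (λ i → point (framed α β i)) ↝ planes (elementary conic) ⊎
                   (λ i → point (framed α β i)) ↝ planes (elementary pointedConic)

  private
    p-zero : p zero ≡ unit
    p-zero = cong₂ _,_ α-zero β-zero

    p-∈ : ∀ k → p (suc k) ∈ candidates
    p-∈ k = ∈-candidates (p (suc k)) (T-∧⁺
      (T-not⁺ (α-nonzero (suc k) ∘ isZero-sound)) (T-∧⁺ (T-not⁺ (β-nonzero (suc k) ∘ isZero-sound))
      (subst (λ u → T (distinctSlopes u (p (suc k)))) p-zero (slopes {zero} {suc k} (λ ())))))

    p-compatible : ∀ {k l} → k ≢ l → T (compatible (p (suc k)) (p (suc l)))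
    p-compatible {k} {l} k≢l = T-∧⁺ (slopes (k≢l ∘ suc-injective))
      (subst (λ u → T (noncollinear u (p (suc k)) (p (suc l)))) p-zero
        (arc {zero} {suc k} {suc l} (λ ()) (k≢l ∘ suc-injective) (λ ())))

    extends : ∀ k → Arcs.Extends (p (suc zero)) (p (suc (suc zero))) (p (suc (suc (suc k))))
    extends k = p-compatible (λ ()) , p-compatible (λ ()) , arc (λ ()) (λ ()) (λ ())

    abstract
      common : ∃[ M ] (M ∈ hyperovalMaps × T (on M (p (suc zero))) × T (on M (p (suc (suc zero)))) ×
        (∀ {s} → s ∈ candidates → Arcs.Extends (p (suc zero)) (p (suc (suc zero))) s → T (on M s)))
      common = Arcs.sound {hyperovalMaps} {candidates} arcs-checked
        (p-∈ zero) (p-∈ (suc zero)) (p-∈ (suc (suc zero))) (p-compatible (λ ())) (extends zero)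

    M : Frame
    M = proj₁ common

    M-checked : T (not (isZero (det M)) ∧ containsFrame M)
    M-checked = all-elim (λ M → not (isZero (det M)) ∧ containsFrame M) maps-checked (proj₁ (proj₂ common))

    M-det : det M ≢ 0V
    M-det = T-not (proj₁ (T-∧⁻ {not (isZero (det M))} M-checked)) ∘ isZero-complete

    on-frame : T (onHyperoval (lin M X₁)) × T (onHyperoval (lin M X₂)) ×
               T (onHyperoval (lin M X₃)) × T (on M unit)
    on-frame = let t₁ , t = T-∧⁻ {onHyperoval (lin M X₁)} (proj₂ (T-∧⁻ {not (isZero (det M))} M-checked))
                   t₂ , t = T-∧⁻ {onHyperoval (lin M X₂)} t
               in t₁ , t₂ , T-∧⁻ {onHyperoval (lin M X₃)} t

    on-hyperoval : ∀ i → T (onHyperoval (lin M (framed α β i)))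
    on-hyperoval zero                                  = proj₁ on-frame
    on-hyperoval (suc zero)                            = proj₁ (proj₂ on-frame)
    on-hyperoval (suc (suc zero))                      = proj₁ (proj₂ (proj₂ on-frame))
    on-hyperoval (suc (suc (suc zero)))                =
      subst (λ u → T (on M u)) (sym p-zero) (proj₂ (proj₂ (proj₂ on-frame)))
    on-hyperoval (suc (suc (suc (suc zero))))          = proj₁ (proj₂ (proj₂ common))
    on-hyperoval (suc (suc (suc (suc (suc zero)))))    = proj₁ (proj₂ (proj₂ (proj₂ common)))
    on-hyperoval (suc (suc (suc (suc (suc (suc k)))))) =
      proj₂ (proj₂ (proj₂ (proj₂ common))) (p-∈ (suc (suc k))) (extends k)

    framed-nonzero : ∀ i → framed α β i ≢ 0P
    framed-nonzero zero                ()
    framed-nonzero (suc zero)          ()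
    framed-nonzero (suc (suc zero))    ()
    framed-nonzero (suc (suc (suc k))) ()

    lin-nonzero : ∀ X → X ≢ 0P → lin M X ≢ 0P
    lin-nonzero (a , b , c) X≢0 eq =
      let a≡0 , b≡0 , c≡0 = lin-kernel (proj₁ M) (proj₁ (proj₂ M)) (proj₂ (proj₂ M)) a b c M-det eq
      in X≢0 (triple-≡ a≡0 b≡0 c≡0)

    abstract
      position : ∀ i → ∃[ j ] ∃[ l ] (l ≢ 0V × lin M (framed α β i) ≡ scaleP l (hyperoval j))
      position i = onHyperoval⇒proportional (lin M (framed α β i))
        (lin-nonzero (framed α β i) (framed-nonzero i)) (on-hyperoval i)

    j : Fin 9 → Fin 10
    j i = proj₁ (position i)

    lam : Fin 9 → GF8
    lam i = proj₁ (proj₂ (position i))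

    lamᴵ : Fin 9 → Iso 3
    lamᴵ i = scaleᴵ (lam i) (proj₁ (proj₂ (proj₂ (position i))))

    to-hyperoval : ∀ i a → lift M (point (framed α β i) a) ≡ point (hyperoval (j i)) (a *8 lam i)
    to-hyperoval i a = trans (lift-point M (framed α β i) a)
      (trans (cong (λ X → point X a) (proj₂ (proj₂ (proj₂ (position i)))))
             (point-scaleP (lam i) (hyperoval (j i)) a))

  conic-or-pointed : ConicOrPointed
  conic-or-pointed = by-missed (missed-value j)
    where
    on-conic : ∀ k → k ≢ zero → ∃[ i ] hyperoval k ≡ conic i
    on-conic zero    k≢0 = ⊥-elim (k≢0 refl)
    on-conic (suc i) k≢0 = i , refl

    by-missed : ∃[ h ] (∀ i → j i ≢ h) → ConicOrPointed
    -- Index zero of `hyperoval` is the nucleus, so here all the points lie on the conic itself.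
    by-missed (zero , missed) = inj₁ (liftᴵ M M-det , λ i →
      let i′ , eq = on-conic (j i) (missed i) in
      i′ , lamᴵ i , λ a → trans (to-hyperoval i a)
        (trans (cong (λ X → point X (a *8 lam i)) eq) (sym (span-pointSubspace (conic i′) (a *8 lam i)))))
    by-missed (suc h , missed) = inj₂ (liftᴵ N (move-det h) ∘ᴵ liftᴵ M M-det , λ i →
      let j′ , m , m≢0 , eq = move-proportional h (j i) (missed i ∘ sym) in
      j′ , scaleᴵ m m≢0 ∘ᴵ lamᴵ i , λ a → (begin
        lift N (lift M (point (framed α β i) a))      ≡⟨ cong (lift N) (to-hyperoval i a) ⟩
        lift N (point (hyperoval (j i)) (a *8 lam i)) ≡⟨ lift-point N (hyperoval (j i)) (a *8 lam i) ⟩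
        point (lin N (hyperoval (j i))) (a *8 lam i)  ≡⟨ cong (λ X → point X (a *8 lam i)) eq ⟩
        point (scaleP m (pointedConic j′)) (a *8 lam i) ≡⟨ point-scaleP m (pointedConic j′) (a *8 lam i) ⟩
        point (pointedConic j′) ((a *8 lam i) *8 m)
          ≡⟨ sym (span-pointSubspace (pointedConic j′) ((a *8 lam i) *8 m)) ⟩
        planes (elementary pointedConic) j′ ((a *8 lam i) *8 m) ∎))
      where
      open ≡-Reasoning
      N : Frame
      N = moveToInfinity h

-- Classification of the pseudo-ovals

Framed : Family → Set
Framed O = ∃[ α ] ∃[ β ] (α zero ≡ one8 × β zero ≡ one8 × planes O ≅ (λ i → point (framed α β i)))

pseudoOval-framed : ∀ O → IsPseudoOval O → Framed O
pseudoOval-framed O oval = compose (graphs-over-GF8 {P} {Q} P-zero Q-zero (≅-independent normal-form ind))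
  where
  ind : Independent (planes O)
  ind = pseudoOval⇒independent {O} oval
  open Normalise {planes O} (λ i → span-additive (O i)) ind
  compose : OverGF8 P Q → Framed O
  compose (α , β , α-zero , β-zero , over-GF8) = α , β , α-zero , β-zero ,
    ≅-trans {planes O} {graphs P Q} {λ i → point (framed α β i)} normal-form over-GF8

classification : ∀ (O : Family) → IsPseudoOval O →
  Equivalent O (elementary conic) ⊎ Equivalent O (elementary pointedConic)
classification O oval = classify (pseudoOval-framed O oval)
  where
  classify : Framed O → Equivalent O (elementary conic) ⊎ Equivalent O (elementary pointedConic)
  classify (α , β , α-zero , β-zero , form) = Sum.map (finish conic) (finish pointedConic)
    (FramedOval.conic-or-pointed {α} {β} α-zero β-zero
      (≅-independent {planes O} {λ i → point (framed α β i)} form (pseudoOval⇒independent {O} oval)))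
    where
    finish : ∀ Xs → (λ i → point (framed α β i)) ↝ planes (elementary Xs) → Equivalent O (elementary Xs)
    finish Xs e = ↝⇒Equivalent {O} {elementary Xs}
      (≅-↝-trans {planes O} {λ i → point (framed α β i)} {planes (elementary Xs)} form e)

-- Conics and pointed conics

fins₃ : List (Fin 9 × Fin 9 × Fin 9)
fins₃ = cartesianProduct (allFin 9) (cartesianProduct (allFin 9) (allFin 9))

arc₃ : (Fin 9 → Point28) → Fin 9 × Fin 9 × Fin 9 → Bool
arc₃ Xs (i , j , k) = ⌊ i ≟ j ⌋ ∨ ⌊ j ≟ k ⌋ ∨ ⌊ i ≟ k ⌋ ∨ not (isZero (det₈ (Xs i) (Xs j) (Xs k)))

arc⇒pseudoOval : ∀ Xs → all (arc₃ Xs) fins₃ ≡ true → IsPseudoOval (elementary Xs)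
arc⇒pseudoOval Xs ok = independent⇒pseudoOval {elementary Xs} λ {i} {j} {k} i≢j j≢k i≢k a b c eq →
  points-independent (Xs i) (Xs j) (Xs k) (det≢0 i≢j j≢k i≢k) a b c
    (trans (sym (cong₂ _⊕_ (span-pointSubspace (Xs i) a)
      (cong₂ _⊕_ (span-pointSubspace (Xs j) b) (span-pointSubspace (Xs k) c)))) eq)
  where
  skip : ∀ {i j : Fin 9} {b} → i ≢ j → T (⌊ i ≟ j ⌋ ∨ b) → T b
  skip {i} {j} i≢j t = [ (λ eq → ⊥-elim (i≢j (toWitness eq))) , (λ b → b) ]′ (T-∨⁻ {⌊ i ≟ j ⌋} t)

  det≢0 : ∀ {i j k} → i ≢ j → j ≢ k → i ≢ k → det₈ (Xs i) (Xs j) (Xs k) ≢ 0V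
  det≢0 {i} {j} {k} i≢j j≢k i≢k = T-not (skip i≢k (skip j≢k (skip i≢j (all-elim (arc₃ Xs) ok
    (∈-cartesianProduct⁺ (∈-allFin i) (∈-cartesianProduct⁺ (∈-allFin j) (∈-allFin k))))))) ∘ isZero-complete

conic-pseudoOval : IsPseudoOval (elementary conic)
conic-pseudoOval = arc⇒pseudoOval conic refl

pointedConic-pseudoOval : IsPseudoOval (elementary pointedConic)
pointedConic-pseudoOval = arc⇒pseudoOval pointedConic refl

-- Quadratic maps

tensor : ∀ {m n} → V m → V n → Vec (V n) m
tensor v w = map (λ b → scale b w) v

-- The linear map induced by `b` on the tensor product, whose elements are represented by m × n
-- matrices.
contract : ∀ {m n k} → (V m → V n → V k) → Vec (V n) m → V k
contract b []       = 0V
contract b (r ∷ rs) = b (true ∷ 0V) r ⊕ contract (λ v → b (false ∷ v)) rs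

Biadditive : ∀ {m n k} → (V m → V n → V k) → Set
Biadditive b = (∀ w → Additive (λ v → b v w)) × (∀ v → Additive (b v))

restrict : ∀ {m n k} {b : V (suc m) → V n → V k} → Biadditive b → Biadditive (λ v → b (false ∷ v))
restrict (addˡ , addʳ) = (λ w x y → addˡ w (false ∷ x) (false ∷ y)) , λ v → addʳ (false ∷ v)

contract-tensor : ∀ {m n k} {b : V m → V n → V k} → Biadditive b → ∀ v w → contract b (tensor v w) ≡ b v w
contract-tensor b-add [] w = sym (additive-zero (proj₁ b-add w))
contract-tensor {b = b} b-add@(addˡ , addʳ) (x ∷ v) w = begin
  b (true ∷ 0V) (scale x w) ⊕ contract (λ v → b (false ∷ v)) (tensor v w)
    ≡⟨ cong₂ _⊕_ (head-term x) (contract-tensor (restrict {b = b} b-add) v w) ⟩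
  b (x ∷ 0V) w ⊕ b (false ∷ v) w
    ≡⟨ sym (addˡ w (x ∷ 0V) (false ∷ v)) ⟩
  b ((x xor false) ∷ (0V ⊕ v)) w
    ≡⟨ cong₂ (λ y u → b (y ∷ u) w) (xor-identityʳ x) (⊕-identityˡ v) ⟩
  b (x ∷ v) w ∎
  where
  open ≡-Reasoning
  head-term : ∀ x → b (true ∷ 0V) (scale x w) ≡ b (x ∷ 0V) w
  head-term true  = cong (b (true ∷ 0V)) (scale-true w)
  head-term false = trans (cong (b (true ∷ 0V)) (scale-false w))
    (trans (additive-zero (addʳ (true ∷ 0V))) (sym (additive-zero (addˡ w))))

contract-⊕ : ∀ {m n k} {b : V m → V n → V k} → Biadditive b → ∀ R R′ →
             contract b (zipWith _⊕_ R R′) ≡ contract b R ⊕ contract b R′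
contract-⊕ b-add []      []        = sym (⊕-self 0V)
contract-⊕ {b = b} b-add (r ∷ R) (r′ ∷ R′) = trans
  (cong₂ _⊕_ (proj₂ b-add (true ∷ 0V) r r′) (contract-⊕ (restrict {b = b} b-add) R R′))
  (⊕-interchange (b (true ∷ 0V) r) (b (true ∷ 0V) r′) _ _)

contract-zero : ∀ {m n k} {b : V m → V n → V k} → Biadditive b → contract b (replicate m 0V) ≡ 0V
contract-zero {zero}  b-add = refl
contract-zero {suc m} {b = b} b-add = trans
  (cong₂ _⊕_ (additive-zero (proj₂ b-add (true ∷ 0V))) (contract-zero (restrict {b = b} b-add))) (⊕-self 0V)

squares : ∀ {n} → List (V n) → Vec (V n) n
squares {n} = foldr (λ t R → zipWith _⊕_ (tensor t t) R) (replicate n 0V)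

contract-squares : ∀ {n k} {b : V n → V n → V k} → Biadditive b →
  ∀ ts → contract b (squares ts) ≡ foldr (λ t s → b t t ⊕ s) 0V ts
contract-squares b-add []       = contract-zero b-add
contract-squares b-add (t ∷ ts) = trans (contract-⊕ b-add (tensor t t) (squares ts))
  (cong₂ _⊕_ (contract-tensor b-add t t) (contract-squares b-add ts))

-- The value `b t t` is linear in the tensor square of `t`, so every quadratic map inherits a linear
-- relation between tensor squares; in such a relation the value at one vector is the sum of the
-- values at the others.
quadratic-vanishes : ∀ {n k} {b : V n → V n → V k} → Biadditive b → ∀ t ts →
  squares (t ∷ ts) ≡ replicate n 0V → (∀ {s} → s ∈ ts → b s s ≡ 0V) → b t t ≡ 0V
quadratic-vanishes {b = b} b-add t ts total vanish = begin
  b t t                                    ≡⟨ sym (⊕-identityʳ (b t t)) ⟩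
  b t t ⊕ 0V                               ≡⟨ cong (b t t ⊕_) (sym (tail-zero ts vanish)) ⟩
  foldr (λ t s → b t t ⊕ s) 0V (t ∷ ts)    ≡⟨ sym (contract-squares b-add (t ∷ ts)) ⟩
  contract b (squares (t ∷ ts))            ≡⟨ cong (contract b) total ⟩
  contract b (replicate _ 0V)              ≡⟨ contract-zero b-add ⟩
  0V                                       ∎
  where
  open ≡-Reasoning
  tail-zero : ∀ ts → (∀ {s} → s ∈ ts → b s s ≡ 0V) → foldr (λ t s → b t t ⊕ s) 0V ts ≡ 0V
  tail-zero []       _      = refl
  tail-zero (t ∷ ts) vanish =
    trans (cong₂ _⊕_ (vanish (here refl)) (tail-zero ts (vanish ∘ there))) (⊕-self 0V)

-- In characteristic two the polar form does not determine a quadratic form, so y² + xz is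
-- represented as the diagonal of a biadditive map that is not symmetric.
conicForm : V9 → V9 → V 3
conicForm v w = (π₂ v *8 π₂ w) ⊕ (π₁ v *8 π₃ w)

conicForm-biadditive : Biadditive conicForm
conicForm-biadditive =
    (λ w → ⊕-additive {f = λ v → π₂ v *8 π₂ w} {λ v → π₁ v *8 π₃ w}
       (∘-additive {g = _*8 π₂ w} {π₂} (*8-additiveˡ (π₂ w)) π₂-additive)
       (∘-additive {g = _*8 π₃ w} {π₁} (*8-additiveˡ (π₃ w)) π₁-additive))
  , (λ v → ⊕-additive {f = λ w → π₂ v *8 π₂ w} {λ w → π₁ v *8 π₃ w}
       (∘-additive {g = π₂ v *8_} {π₂} (*8-additiveʳ (π₂ v)) π₂-additive)
       (∘-additive {g = π₁ v *8_} {π₃} (*8-additiveʳ (π₁ v)) π₃-additive))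

conicForm-conic : ∀ i a → conicForm (point (conic i) a) (point (conic i) a) ≡ 0V
conicForm-conic i a = isZero-sound (all-elim
  (λ (i , a) → isZero (conicForm (point (conic i) a) (point (conic i) a)))
  {cartesianProduct (allFin 9) (vectors 3)} refl (∈-cartesianProduct⁺ (∈-allFin i) (∈-vectors a)))

conicForm-zero : ∀ v → v ≢ 0V → conicForm v v ≡ 0V → ∃[ i ] ∃[ a ] v ≡ point (conic i) a
conicForm-zero v v≢0 q≡0 =
  let i , l , _ , eq = isOneOf-elim conic (π₁ v , π₂ v , π₃ v)
        (nonzero (T-⇒ (all-elim test {vectors 9} refl (∈-vectors v)) (isZero-complete q≡0)))
  in i , l , trans (sym (toV9-π v)) (cong toV9 eq)
  where
  test : V9 → Bool
  test v = isZero (conicForm v v) ⇒ isZero v ∨ isOneOf conic (π₁ v , π₂ v , π₃ v)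
  nonzero : ∀ {b} → T (isZero v ∨ b) → T b
  nonzero t = [ (λ z → ⊥-elim (v≢0 (isZero-sound z))) , (λ b → b) ]′ (T-∨⁻ {isZero v} t)

conic-disjoint : ∀ i j b → point (conic i) one8 ≡ point (conic j) b → i ≡ j
conic-disjoint i j b eq = toWitness (T-⇒ (all-elim
  (λ (i , j , b) → (point (conic i) one8 == point (conic j) b) ⇒ ⌊ i ≟ j ⌋)
  {cartesianProduct (allFin 9) (cartesianProduct (allFin 9) (vectors 3))} refl
  (∈-cartesianProduct⁺ (∈-allFin i) (∈-cartesianProduct⁺ (∈-allFin j) (∈-vectors b)))) (==-complete eq))

nucleus∉pointedConic : ∀ j b → toV9 X₃ ≢ point (pointedConic j) b
nucleus∉pointedConic j b = T-not (all-elim (λ (j , b) → not (toV9 X₃ == point (pointedConic j) b))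
  {cartesianProduct (allFin 9) (vectors 3)} refl (∈-cartesianProduct⁺ (∈-allFin j) (∈-vectors b)))
  ∘ ==-complete

-- The conic in the parameter u = 1/t: for u ≠ 0 this is u² (1, t, t²), a point common to both
-- ovals, while u = 0 gives (0,0,1). The choice of multiples matters, since the tensor squares have
-- to cancel as matrices over GF(2).
conicPoint : GF8 → Point28
conicPoint u = (u *8 u , u , one8)

conicPoint-pointed : ∀ {u} → u ∈ units → ∃[ j ] ∃[ l ] conicPoint u ≡ scaleP l (pointedConic j)
conicPoint-pointed {u} u∈ =
  let j , l , _ , eq = isOneOf-elim pointedConic (conicPoint u)
        (all-elim (isOneOf pointedConic ∘ conicPoint) {units} refl u∈)
  in j , l , eq

-- The entries of v ⊗ v for v = (u², u, 1) are GF(8)-linear combinations of the powers u^k with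
-- 0 ≤ k < 7, and each of these sums to zero over u ∈ GF(8).
squares-conicPoints : squares (toV9 X₃ ∷ List.map (toV9 ∘ conicPoint) units) ≡ replicate 9 0V
squares-conicPoints = refl

-- Inequivalence of the conic and the pointed conic

not-equivalent : ¬ Equivalent (elementary conic) (elementary pointedConic)
not-equivalent (M , (N , NM , MN) , carry) = nucleus∉pointedConic (j i₀) b₀ n≡
  where
  O O′ : Family
  O  = elementary conic
  O′ = elementary pointedConic

  j : Fin 9 → Fin 9
  j i = proj₁ (carry i)

  forward : ∀ i a → ∃[ b ] apply M (point (conic i) a) ≡ point (pointedConic (j i)) b
  forward i a =
    let b , eq = ∈S⇒span (O′ (j i)) (proj₁ (proj₂ (carry i) (apply M (point (conic i) a)))
          (span⇒∈S (image M (O i)) a (trans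
            (cong (apply M) (sym (span-pointSubspace (conic i) a))) (sym (span-image M (O i) a)))))
    in b , trans eq (span-pointSubspace (pointedConic (j i)) b)

  backward : ∀ i b → ∃[ a ] point (pointedConic (j i)) b ≡ apply M (point (conic i) a)
  backward i b =
    let a , eq = ∈S⇒span (image M (O i)) (proj₂ (proj₂ (carry i) (point (pointedConic (j i)) b))
          (span⇒∈S (O′ (j i)) b (sym (span-pointSubspace (pointedConic (j i)) b))))
    in a , trans eq (trans (span-image M (O i) a) (cong (apply M) (span-pointSubspace (conic i) a)))

  M-injective : ∀ {v w} → apply M v ≡ apply M w → v ≡ w
  M-injective {v} {w} eq = trans (sym (NM v)) (trans (cong (apply N) eq) (NM w))

  -- An equivalence names a target for each plane of the conic, whereas the transported form must
  -- vanish on every plane of the pointed conic, so `j` has to be onto. As there are nine labels on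
  -- each side, injectivity suffices; it holds because distinct planes of the conic share no nonzero
  -- vector.
  j-injective : Injective _≡_ _≡_ j
  j-injective {i} {i′} ji≡ji′ =
    let b , eq  = forward i one8
        a , eq′ = backward i′ b
    in conic-disjoint i i′ a (M-injective
         (trans eq (trans (cong (λ k → point (pointedConic k) b) ji≡ji′) eq′)))

  form : V9 → V9 → V 3
  form v w = conicForm (apply N v) (apply N w)

  form-biadditive : Biadditive form
  form-biadditive =
      (λ w x y → trans (cong (λ u → conicForm u (apply N w)) (apply-additive N x y))
                       (proj₁ conicForm-biadditive (apply N w) (apply N x) (apply N y)))
    , (λ v x y → trans (cong (conicForm (apply N v)) (apply-additive N x y))
                       (proj₂ conicForm-biadditive (apply N v) (apply N x) (apply N y)))

  form-pointed : ∀ k b → form (point (pointedConic k) b) (point (pointedConic k) b) ≡ 0V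
  form-pointed k b =
    let i , ji≡k = injective⇒surjective j-injective k
        a , eq   = backward i b
        N≡       = trans (cong (λ k → apply N (point (pointedConic k) b)) (sym ji≡k))
                     (trans (cong (apply N) eq) (NM (point (conic i) a)))
    in trans (cong₂ conicForm N≡ N≡) (conicForm-conic i a)

  n : V9
  n = toV9 X₃

  form-n : form n n ≡ 0V
  form-n = quadratic-vanishes form-biadditive n
    (List.map (toV9 ∘ conicPoint) units) squares-conicPoints vanish
    where
    vanish : ∀ {s} → s ∈ List.map (toV9 ∘ conicPoint) units → form s s ≡ 0V
    vanish s∈ =
      let u , u∈ , s≡ = ∈-map⁻ (toV9 ∘ conicPoint) s∈
          k , l , eq  = conicPoint-pointed u∈
          s≡′         = trans s≡ (cong toV9 eq)
      in trans (cong₂ form s≡′ s≡′) (form-pointed k l)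

  Nn≢0 : apply N n ≢ 0V
  Nn≢0 eq = T-not {isZero n} tt (isZero-complete
    (trans (sym (MN n)) (trans (cong (apply M) eq) (additive-zero (apply-additive M)))))

  on-conic : ∃[ i ] ∃[ a ] apply N n ≡ point (conic i) a
  on-conic = conicForm-zero (apply N n) Nn≢0 form-n

  i₀ : Fin 9
  i₀ = proj₁ on-conic

  image-n : ∃[ b ] apply M (point (conic i₀) (proj₁ (proj₂ on-conic))) ≡ point (pointedConic (j i₀)) b
  image-n = forward i₀ (proj₁ (proj₂ on-conic))

  b₀ : V 3
  b₀ = proj₁ image-n

  n≡ : n ≡ point (pointedConic (j i₀)) b₀
  n≡ = trans (sym (MN n)) (trans (cong (apply M) (proj₂ (proj₂ on-conic))) (proj₂ image-n))

theorem5 : IsPseudoOval (elementary conic) × IsPseudoOval (elementary pointedConic)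
    × ¬ Equivalent (elementary conic) (elementary pointedConic)
    × (∀ (O : Family) → IsPseudoOval O →
    Equivalent O (elementary conic) ⊎ Equivalent O (elementary pointedConic))
theorem5 = conic-pseudoOval , pointedConic-pseudoOval , not-equivalent , classification
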